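{- Let $n\ge 1$. There is a bijection $\varphi:F_n\to PF_n$ from the set $F_n$ of rooted forests on the vertex set $\{1,\dots,n\}$ onto the set $PF_n$ of parking functions of length $n$ such that for every $F\in F_n$, $$(\mathrm{tinv}(F),\mathrm{tree}(F))=(\mathrm{tjump}(\varphi(F)),\mathrm{critic}(\varphi(F))).$$
   Context: A rooted forest on $\{1,\dots,n\}$ is a simple graph on the labeled vertex set $\{1,\dots,n\}$ each of whose connected components is a tree with one distinguished vertex (its root). A vertex $x$ is a descendant of a vertex $v$ if $x\neq v$ and $v$ lies on the unique path from the root of its component to $x$. For $F\in F_n$ and a vertex $v$, $\mathrm{inv}(F:v)$ is the number of descendants $x$ of $v$ with $x<v$. For $0\le i\le n$, $\mathrm{lead}_i(F)$ is the number of vertices $v$ with $\mathrm{inv}(F:v)=i$, and $\mathrm{tinv}(F)=(\mathrm{lead}_0(F),\dots,\mathrm{lead}_n(F))$. $\mathrm{tree}(F)$ is the number of connected components (trees) of $F$. Parking algorithm: given a sequence $(p_1,\dots,p_n)$ of positive integers, cars $1,2,\dots,n$ arrive in this order at a one-way street of parking spaces $1,2,3,\dots$; car $i$ goes to space $p_i$ and parks there if it is empty, otherwise it tries $p_i+1,p_i+2,\dots$ and parks in the first empty space; let $q_i$ be the space where car $i$ parks. The sequence is a parking function of length $n$ if $q_i\le n$ for all $i$. For a parking function $P=(p_1,\dots,p_n)$ and a car $c$, $\mathrm{jump}(P:c)=q_c-p_c$. For $0\le i\le n$, $\mathrm{lucky}_i(P)$ is the number of cars $c$ with $\mathrm{jump}(P:c)=i$,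 and $\mathrm{tjump}(P)=(\mathrm{lucky}_0(P),\dots,\mathrm{lucky}_n(P))$. A car $c$ is critical if, immediately after car $c$ has parked, all spaces $q_c+1,\dots,n$ are occupied (equivalently, every car $d$ with $q_d>q_c$ satisfies $d<c$); $\mathrm{critic}(P)$ is the number of critical cars. -}

module Defs where

open import Data.Nat using (ℕ; zero; suc; _+_; _∸_; _≤ᵇ_; _<ᵇ_; _≡ᵇ_)
open import Data.Bool using (Bool; true; false; if_then_else_; _∧_; _∨_; T; not)
open import Data.Fin using (Fin; toℕ)
open import Data.Maybe using (Maybe; just; nothing; _>>=_)
open import Data.Vec using (Vec; lookup; toList; _∷_; [])
open import Data.List using (List; map; allFin)
open import Data.Nat.ListAction using (sum)
open import Data.Bool.ListAction using (any; all)
open import Data.List.Base as L using ()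
open import Data.Product using (Σ; _,_)

count : ∀ {n} → (Fin n → Bool) → ℕ
count {n} f = sum (map (λ i → if f i then 1 else 0) (allFin n))

finEq : ∀ {n} → Fin n → Fin n → Bool
finEq a b = toℕ a ≡ᵇ toℕ b

finLt : ∀ {n} → Fin n → Fin n → Bool
finLt a b = toℕ a <ᵇ toℕ b

isNothing : ∀ {A : Set} → Maybe A → Bool
isNothing nothing = true
isNothing (just _) = false

isJust-eq : ∀ {n} → Maybe (Fin n) → Fin n → Bool
isJust-eq nothing _ = false
isJust-eq (just a) b = finEq a b

-- Rooted forests on vertex set Fin n (vertex i ↔ i+1), encoded by the
-- parent function: lookup par v = nothing iff v is a root, otherwise
-- just (parent of v).  The parent function must be acyclic.

ParentFun : ℕ → Set
ParentFun n = Vec (Maybe (Fin n)) n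

anc : ∀ {n} → ParentFun n → ℕ → Fin n → Maybe (Fin n)
anc par zero v = just v
anc par (suc k) v = anc par k v >>= lookup par

isForest : ∀ {n} → ParentFun n → Bool
isForest {n} par = all (λ v → isNothing (anc par n v)) (allFin n)

Forest : ℕ → Set
Forest n = Σ (ParentFun n) (λ par → T (isForest par))

isDesc : ∀ {n} → ParentFun n → Fin n → Fin n → Bool
isDesc {n} par x v = any (λ k → isJust-eq (anc par (suc k) x) v) (L.upTo n)

inv : ∀ {n} → Forest n → Fin n → ℕ
inv (par , _) v = count (λ x → finLt x v ∧ isDesc par x v)

lead : ∀ {n} → ℕ → Forest n → ℕ
lead i F = count (λ v → inv F v ≡ᵇ i)

tinv : ∀ {n} → Forest n → Vec ℕ (suc n)
tinv {n} F = Data.Vec.tabulate (λ (i : Fin (suc n)) → lead (toℕ i) F)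

tree : ∀ {n} → Forest n → ℕ
tree (par , _) = count (λ v → isNothing (lookup par v))

-- Parking functions. Cars are Fin n (car i ↔ car i+1), spaces are ℕ
-- (positive integers 1,2,3,... as in the paper).

memb : ℕ → List ℕ → Bool
memb x = any (λ y → x ≡ᵇ y)

-- first free space ≥ p, given the occupied spaces (fuel bounds the search;
-- fuel = length occ + 1 always suffices)
findFree : ℕ → List ℕ → ℕ → ℕ
findFree zero occ p = p
findFree (suc fuel) occ p = if memb p occ then findFree fuel occ (suc p) else p

parkFrom : ∀ {m} → List ℕ → Vec ℕ m → Vec ℕ m
parkFrom occ [] = []
parkFrom occ (p ∷ ps) = let q = findFree (suc (L.length occ)) occ p in q ∷ parkFrom (q L.∷ occ) ps

spaces : ∀ {n} → Vec ℕ n → Vec ℕ n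
spaces = parkFrom L.[]

isParking : ∀ {n} → Vec ℕ n → Bool
isParking {n} ps = all (λ p → 1 ≤ᵇ p) (toList ps) ∧ all (λ q → q ≤ᵇ n) (toList (spaces ps))

PF : ℕ → Set
PF n = Σ (Vec ℕ n) (λ ps → T (isParking ps))

jump : ∀ {n} → PF n → Fin n → ℕ
jump (ps , _) c = lookup (spaces ps) c ∸ lookup ps c

lucky : ∀ {n} → ℕ → PF n → ℕ
lucky i P = count (λ c → jump P c ≡ᵇ i)

tjump : ∀ {n} → PF n → Vec ℕ (suc n)
tjump {n} P = Data.Vec.tabulate (λ (i : Fin (suc n)) → lucky (toℕ i) P)

isCritical : ∀ {n} → PF n → Fin n → Bool
isCritical {n} (ps , _) c =
  all (λ d → not (lookup (spaces ps) c <ᵇ lookup (spaces ps) d) ∨ finLt d c) (allFin n)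

critic : ∀ {n} → PF n → ℕ
critic P = count (isCritical P)

{-# OPTIONS --safe #-}
module Submission where

-- Rooted forests and parking functions decompose in the same way.  Removing the root of the tree
-- that contains the smallest vertex of a forest on n + 1 vertices leaves a forest on a vertices
-- (the rest of that tree) and one on b = n - a vertices (the other trees); the removed root has any
-- rank r among the a + 1 vertices of its tree, and r is its number of inversions.  Removing the
-- last of n + 1 cars, parked at space a + 1, leaves a parking function of the a cars before it
-- and, after a shift, one of the b cars behind it; the last car has any jump r with 0 <= r <= a.
-- In both cases labels are standardised monotonically, the inversions and jumps of the two parts
-- are unchanged, and the number of trees (of critical cars) is one more than in the second part.
-- So both families are in bijection with one family of recursive codes.

open import Defs
open import Data.Bool using (Bool; true; false; T; if_then_else_; _∧_; _∨_; not)
open import Data.Bool.ListAction using (all)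
open import Data.Bool.Properties using (T-irrelevant; T-≡; T-∧; ∧-zeroʳ; ∧-identityʳ)
open import Data.Empty using (⊥; ⊥-elim)
open import Data.Fin using (Fin; zero; suc; toℕ; fromℕ; fromℕ<; inject₁; punchIn; punchOut; _≟_)
open import Data.Fin.Properties
  using (toℕ-injective; toℕ<n; toℕ≤pred[n]; toℕ-inject₁; toℕ-fromℕ; toℕ-fromℕ<; fromℕ<-injective;
         injective⇒≤; pigeonhole; punchInᵢ≢i; punchOut-cong; punchOut-punchIn; punchIn-punchOut)
open import Data.Fin.Relation.Unary.Top using (view; ‵fromℕ; ‵inject₁)
open import Data.List as List using (List; allFin; upTo)
open import Data.List.Membership.Propositional using (_∈_; lose)
open import Data.List.Membership.Propositional.Properties using (∈-upTo⁺)
open import Data.List.Properties using (map-tabulate)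
open import Data.List.Relation.Unary.All.Properties using (all⁺; all⁻; tabulate⁺; tabulate⁻)
open import Data.List.Relation.Unary.Any as Any using (here; there; satisfied)
open import Data.List.Relation.Unary.Any.Properties using (any⁺; any⁻)
open import Data.Maybe as Maybe using (Maybe; just; nothing; maybe′; _>>=_)
open import Data.Maybe.Properties using (just-injective; map-injective; map-∘)
open import Data.Nat
  using (ℕ; zero; suc; _+_; _*_; _∸_; _≤_; _<_; _≡ᵇ_; _≤ᵇ_; _<ᵇ_; z≤n; s≤s; s≤s⁻¹)
open import Data.Nat.Induction using (Acc; acc; <-wellFounded)
open import Data.Nat.ListAction using (sum)
open import Data.Nat.Properties hiding (_≟_)
open import Algebra.Properties.CommutativeSemigroup +-commutativeSemigroup using (x∙yz≈y∙xz)
open import Data.Product using (Σ; ∃; _×_; _,_; proj₁; proj₂)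
open import Data.Sum as Sum using (_⊎_; inj₁; inj₂; [_,_]′)
open import Data.Sum.Properties using (inj₁-injective)
open import Data.Unit using (⊤)
open import Data.Vec using (Vec; []; _∷_; _∷ʳ_; lookup; tabulate; toList; initLast)
open import Data.Vec.Properties using (lookup∘tabulate; tabulate-cong; tabulate∘lookup; ∷ʳ-injective)
open import Function using (_∘_; Equivalence)
open import Function.Bundles using (_⤖_; Bijection; mk⤖)
open import Function.Consequences.Propositional using (strictlySurjective⇒surjective)
open import Function.Construct.Composition using (_⤖-∘_)
open import Function.Construct.Symmetry using (⤖-sym)
open import Relation.Binary.Definitions using (tri<; tri≈; tri>)
open import Relation.Binary.PropositionalEquality
open import Relation.Nullary using (¬_; yes; no; does; contradiction)
open import Relation.Nullary.Decidable using (dec-true)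
open ≡-Reasoning

-- The two kinds of choice agree in number. Nothing ties the label of a root to the labels below it,
-- so its rank takes any of a + 1 values. When the last car arrives, the spaces 1 to a are full and
-- a + 1 is empty, so each preference from 1 to a + 1 ends at a + 1. The smallest vertex merely
-- singles out one tree; as it lies there by definition, only the other n vertices are distributed,
-- just like the n cars before the last. The parking process splits because the space of the last
-- car is empty until the end, so no earlier car gets past it; counting then forces the sizes of the
-- two groups. On the forest side the obstacle is that acyclicity is tested with as many steps as
-- there are vertices, a number that changes when a forest is cut. `anc-bound` shows that any bound
-- on the length of a chain can be replaced by the number of vertices.

T-ext : ∀ {p q} → (T p → T q) → (T q → T p) → p ≡ q
T-ext {false} {false} _ _ = refl
T-ext {false} {true}  _ g = ⊥-elim (g _)
T-ext {true}  {false} f _ = ⊥-elim (f _)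
T-ext {true}  {true}  _ _ = refl

-- Counting

ind : Bool → ℕ
ind p = if p then 1 else 0

count-suc : ∀ {n} (f : Fin (suc n) → Bool) → count f ≡ ind (f zero) + count (f ∘ suc)
count-suc {n} f = cong (λ l → ind (f zero) + sum l)
  (trans (map-tabulate suc (ind ∘ f)) (sym (map-tabulate (λ i → i) (ind ∘ f ∘ suc))))

count-cong : ∀ {n} {f g : Fin n → Bool} → (∀ i → f i ≡ g i) → count f ≡ count g
count-cong {zero}          eq = refl
count-cong {suc n} {f} {g} eq = begin
  count f                          ≡⟨ count-suc f ⟩
  ind (f zero) + count (f ∘ suc)   ≡⟨ cong₂ _+_ (cong ind (eq zero)) (count-cong (eq ∘ suc)) ⟩
  ind (g zero) + count (g ∘ suc)   ≡⟨ count-suc g ⟨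
  count g                          ∎

count-false : ∀ {n} {f : Fin n → Bool} → (∀ i → f i ≡ false) → count f ≡ 0
count-false {zero}      eq = refl
count-false {suc n} {f} eq =
  trans (count-suc f) (cong₂ _+_ (cong ind (eq zero)) (count-false (eq ∘ suc)))

count-punchIn : ∀ {n} (r : Fin (suc n)) (f : Fin (suc n) → Bool) →
                count f ≡ ind (f r) + count (f ∘ punchIn r)
count-punchIn zero                f = count-suc f
count-punchIn {suc n} (suc r) f = begin
  count f
    ≡⟨ count-suc f ⟩
  ind (f zero) + count (f ∘ suc)
    ≡⟨ cong (ind (f zero) +_) (count-punchIn r (f ∘ suc)) ⟩
  ind (f zero) + (ind (f (suc r)) + count (f ∘ suc ∘ punchIn r))
    ≡⟨ x∙yz≈y∙xz (ind (f zero)) (ind (f (suc r))) _ ⟩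
  ind (f (suc r)) + (ind (f zero) + count (f ∘ suc ∘ punchIn r))
    ≡⟨ cong (ind (f (suc r)) +_) (count-suc (f ∘ punchIn (suc r))) ⟨
  ind (f (suc r)) + count (f ∘ punchIn (suc r)) ∎

count-snoc : ∀ {n} (f : Fin (suc n) → Bool) →
             count f ≡ ind (f (fromℕ n)) + count (f ∘ inject₁)
count-snoc {zero}  f = refl
count-snoc {suc n} f = begin
  count f
    ≡⟨ count-suc f ⟩
  ind (f zero) + count (f ∘ suc)
    ≡⟨ cong (ind (f zero) +_) (count-snoc (f ∘ suc)) ⟩
  ind (f zero) + (ind (f (fromℕ (suc n))) + count (f ∘ suc ∘ inject₁))
    ≡⟨ x∙yz≈y∙xz (ind (f zero)) (ind (f (fromℕ (suc n)))) _ ⟩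
  ind (f (fromℕ (suc n))) + (ind (f zero) + count (f ∘ suc ∘ inject₁))
    ≡⟨ cong (ind (f (fromℕ (suc n))) +_) (count-suc (f ∘ inject₁)) ⟨
  ind (f (fromℕ (suc n))) + count (f ∘ inject₁) ∎

-- Shuffles

-- A subset of size `a` of `Fin n` and its complement, as a word in two letters. The increasing
-- enumerations of both are `embL` and `embR`, so monotone standardisation of labels is built in.
data Shuffle : ℕ → ℕ → ℕ → Set where
  []    : Shuffle 0 0 0
  left  : ∀ {a b n} → Shuffle a b n → Shuffle (suc a) b (suc n)
  right : ∀ {a b n} → Shuffle a b n → Shuffle a (suc b) (suc n)

shuffle-size : ∀ {a b n} → Shuffle a b n → a + b ≡ n
shuffle-size []                = refl
shuffle-size (left s)          = cong suc (shuffle-size s)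
shuffle-size (right {a} {b} s) = trans (+-suc a b) (cong suc (shuffle-size s))

embL : ∀ {a b n} → Shuffle a b n → Fin a → Fin n
embL (left s)  zero    = zero
embL (left s)  (suc x) = suc (embL s x)
embL (right s) x       = suc (embL s x)

embR : ∀ {a b n} → Shuffle a b n → Fin b → Fin n
embR (left s)  y       = suc (embR s y)
embR (right s) zero    = zero
embR (right s) (suc y) = suc (embR s y)

locate : ∀ {a b n} → Shuffle a b n → Fin n → Fin a ⊎ Fin b
locate (left s)  zero    = inj₁ zero
locate (left s)  (suc i) = Sum.map₁ suc (locate s i)
locate (right s) zero    = inj₂ zero
locate (right s) (suc i) = Sum.map₂ suc (locate s i)

locate-embL : ∀ {a b n} (s : Shuffle a b n) x → locate s (embL s x) ≡ inj₁ x
locate-embL (left s)  zero    = refl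
locate-embL (left s)  (suc x) rewrite locate-embL s x = refl
locate-embL (right s) x       rewrite locate-embL s x = refl

locate-embR : ∀ {a b n} (s : Shuffle a b n) y → locate s (embR s y) ≡ inj₂ y
locate-embR (left s)  y       rewrite locate-embR s y = refl
locate-embR (right s) zero    = refl
locate-embR (right s) (suc y) rewrite locate-embR s y = refl

data Side {a b n} (s : Shuffle a b n) : Fin n → Set where
  inL : ∀ x → Side s (embL s x)
  inR : ∀ y → Side s (embR s y)

side : ∀ {a b n} (s : Shuffle a b n) i → Side s i
side (left s) zero = inL zero
side (left s) (suc i) with side s i
... | inL x = inL (suc x)
... | inR y = inR y
side (right s) zero = inR zero
side (right s) (suc i) with side s i
... | inL x = inL x
... | inR y = inR (suc y)

finLt-embL : ∀ {a b n} (s : Shuffle a b n) x x′ → finLt (embL s x) (embL s x′) ≡ finLt x x′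
finLt-embL (left s)  zero    zero     = refl
finLt-embL (left s)  zero    (suc x′) = refl
finLt-embL (left s)  (suc x) zero     = refl
finLt-embL (left s)  (suc x) (suc x′) = finLt-embL s x x′
finLt-embL (right s) x       x′       = finLt-embL s x x′

finLt-embR : ∀ {a b n} (s : Shuffle a b n) y y′ → finLt (embR s y) (embR s y′) ≡ finLt y y′
finLt-embR (left s)  y       y′       = finLt-embR s y y′
finLt-embR (right s) zero    zero     = refl
finLt-embR (right s) zero    (suc y′) = refl
finLt-embR (right s) (suc y) zero     = refl
finLt-embR (right s) (suc y) (suc y′) = finLt-embR s y y′

finLt-punchIn : ∀ {n} (r : Fin (suc n)) x x′ → finLt (punchIn r x) (punchIn r x′) ≡ finLt x x′
finLt-punchIn zero    x       x′       = refl
finLt-punchIn (suc r) zero    zero     = refl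
finLt-punchIn (suc r) zero    (suc x′) = refl
finLt-punchIn (suc r) (suc x) zero     = refl
finLt-punchIn (suc r) (suc x) (suc x′) = finLt-punchIn r x x′

count-below-punchIn : ∀ {n} (r : Fin (suc n)) → count (λ x → finLt (punchIn r x) r) ≡ toℕ r
count-below-punchIn {n} zero        = count-false {n} {λ x → finLt (punchIn zero x) zero} (λ _ → refl)
count-below-punchIn {suc n} (suc r) =
  trans (count-suc (λ x → finLt (punchIn (suc r) x) (suc r))) (cong suc (count-below-punchIn r))

count-shuffle : ∀ {a b n} (s : Shuffle a b n) (f : Fin n → Bool) →
                count f ≡ count (f ∘ embL s) + count (f ∘ embR s)
count-shuffle []       f = refl
count-shuffle (left s) f = begin
  count f
    ≡⟨ count-suc f ⟩
  ind (f zero) + count (f ∘ suc)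
    ≡⟨ cong (ind (f zero) +_) (count-shuffle s (f ∘ suc)) ⟩
  ind (f zero) + (count (f ∘ suc ∘ embL s) + count (f ∘ suc ∘ embR s))
    ≡⟨ +-assoc (ind (f zero)) _ _ ⟨
  ind (f zero) + count (f ∘ suc ∘ embL s) + count (f ∘ suc ∘ embR s)
    ≡⟨ cong (_+ count (f ∘ suc ∘ embR s)) (count-suc (f ∘ embL (left s))) ⟨
  count (f ∘ embL (left s)) + count (f ∘ embR (left s)) ∎
count-shuffle (right s) f = begin
  count f
    ≡⟨ count-suc f ⟩
  ind (f zero) + count (f ∘ suc)
    ≡⟨ cong (ind (f zero) +_) (count-shuffle s (f ∘ suc)) ⟩
  ind (f zero) + (count (f ∘ suc ∘ embL s) + count (f ∘ suc ∘ embR s))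
    ≡⟨ x∙yz≈y∙xz (ind (f zero)) (count (f ∘ suc ∘ embL s)) _ ⟩
  count (f ∘ suc ∘ embL s) + (ind (f zero) + count (f ∘ suc ∘ embR s))
    ≡⟨ cong (count (f ∘ suc ∘ embL s) +_) (count-suc (f ∘ embR (right s))) ⟨
  count (f ∘ embL (right s)) + count (f ∘ embR (right s)) ∎

onLeft : ∀ {a b n} → Shuffle a b n → Fin n → Bool
onLeft (left s)  zero    = true
onLeft (right s) zero    = false
onLeft (left s)  (suc i) = onLeft s i
onLeft (right s) (suc i) = onLeft s i

onLeft-embL : ∀ {a b n} (s : Shuffle a b n) x → onLeft s (embL s x) ≡ true
onLeft-embL (left s)  zero    = refl
onLeft-embL (left s)  (suc x) = onLeft-embL s x
onLeft-embL (right s) x       = onLeft-embL s x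

onLeft-embR : ∀ {a b n} (s : Shuffle a b n) y → onLeft s (embR s y) ≡ false
onLeft-embR (left s)  y       = onLeft-embR s y
onLeft-embR (right s) zero    = refl
onLeft-embR (right s) (suc y) = onLeft-embR s y

AnyShuffle : ℕ → Set
AnyShuffle n = Σ ℕ λ a → Σ ℕ λ b → Shuffle a b n

-- The sizes belong to the conclusion because two decompositions of one object have a priori
-- different sizes; a match with `refl` identifies sizes and shuffles together.
onLeft-injective : ∀ {a b a′ b′ n} (s : Shuffle a b n) (s′ : Shuffle a′ b′ n) →
                   (∀ i → onLeft s i ≡ onLeft s′ i) →
                   _≡_ {A = AnyShuffle n} (a , b , s) (a′ , b′ , s′)
onLeft-injective []        []         eq = refl
onLeft-injective (left s)  (right s′) eq with () ← eq zero
onLeft-injective (right s) (left s′)  eq with () ← eq zero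
onLeft-injective (left s)  (left s′)  eq with onLeft-injective s s′ (eq ∘ suc)
... | refl = refl
onLeft-injective (right s) (right s′) eq with onLeft-injective s s′ (eq ∘ suc)
... | refl = refl

shuffleOf : ∀ {n} (f : Fin n → Bool) →
            Σ ℕ λ a → Σ ℕ λ b → Σ (Shuffle a b n) λ s → ∀ i → onLeft s i ≡ f i
shuffleOf {zero}  f = 0 , 0 , [] , λ ()
shuffleOf {suc n} f with shuffleOf (f ∘ suc) | f zero in eq
... | a , b , s , h | true  = suc a , b , left s  , λ { zero → sym eq ; (suc i) → h i }
... | a , b , s , h | false = a , suc b , right s , λ { zero → sym eq ; (suc i) → h i }

-- In node s r c d, for a forest: s says which vertices besides vertex 0 lie in the tree of vertex 0
-- (left), r is the rank of the root of that tree among its vertices, c codes the tree without its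
-- root and d the remaining trees.  For a parking function: s says which cars besides the last one
-- park before it (left) or after it (right), r is the jump of the last car, and c, d code the two
-- groups of cars.
data Code : ℕ → Set where
  leaf : Code 0
  node : ∀ {a b n} → Shuffle a b n → Fin (suc a) → Code a → Code b → Code (suc n)

embL-injective : ∀ {a b n} (s : Shuffle a b n) {x x′} → embL s x ≡ embL s x′ → x ≡ x′
embL-injective s {x} {x′} eq =
  inj₁-injective (trans (sym (locate-embL s x)) (trans (cong (locate s) eq) (locate-embL s x′)))

-- Ancestors

anc-+ : ∀ {n} (par : ParentFun n) j {k v w} →
        anc par k v ≡ just w → anc par (j + k) v ≡ anc par j w
anc-+ par zero    eq = eq
anc-+ par (suc j) eq = cong (_>>= lookup par) (anc-+ par j eq)

anc-nothing-+ : ∀ {n} (par : ParentFun n) j {k v} →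
                anc par k v ≡ nothing → anc par (j + k) v ≡ nothing
anc-nothing-+ par zero    eq = eq
anc-nothing-+ par (suc j) eq = cong (_>>= lookup par) (anc-nothing-+ par j eq)

anc-nothing-≤ : ∀ {n} (par : ParentFun n) {k l v} → k ≤ l →
                anc par k v ≡ nothing → anc par l v ≡ nothing
anc-nothing-≤ par {k} {l} k≤l eq =
  subst (λ i → anc par i _ ≡ nothing) (m∸n+n≡m k≤l) (anc-nothing-+ par (l ∸ k) eq)

anc-cycle : ∀ {n} (par : ParentFun n) {d u} → anc par d u ≡ just u →
            ∀ m → anc par (m * d) u ≡ just u
anc-cycle par             eq zero    = refl
anc-cycle par {d} {u} eq (suc m) = trans (anc-+ par d (anc-cycle par eq m)) eq

Acyclic : ∀ {n} → ParentFun n → Set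
Acyclic {n} par = ∀ v → anc par n v ≡ nothing

-- If the first n + 1 vertices of an ancestor chain exist, two of them coincide and the chain is
-- periodic.
anc-bound : ∀ {n} (par : ParentFun n) k {v} → anc par k v ≡ nothing → anc par n v ≡ nothing
anc-bound {n} par k {v} eq with anc par n v in long
... | nothing = refl
... | just _ = contradiction (trans (sym forever) stops) λ ()
  where
  chain : (i : Fin (suc n)) → ∃ λ u → anc par (toℕ i) v ≡ just u
  chain i with anc par (toℕ i) v in e
  ... | just u  = u , refl
  ... | nothing = contradiction (trans (sym long) (anc-nothing-≤ par (toℕ≤pred[n] i) e)) λ ()

  repeat = pigeonhole (n<1+n n) (proj₁ ∘ chain)
  i = toℕ (proj₁ repeat)
  j = toℕ (proj₁ (proj₂ repeat))
  d = j ∸ i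
  u = proj₁ (chain (proj₁ repeat))

  i<j : i < j
  i<j = proj₁ (proj₂ (proj₂ repeat))

  cycle : anc par d u ≡ just u
  cycle = begin
    anc par d u        ≡⟨ anc-+ par d (proj₂ (chain (proj₁ repeat))) ⟨
    anc par (d + i) v  ≡⟨ cong (λ l → anc par l v) (m∸n+n≡m (<⇒≤ i<j)) ⟩
    anc par j v        ≡⟨ proj₂ (chain (proj₁ (proj₂ repeat))) ⟩
    just _             ≡⟨ cong just (proj₂ (proj₂ (proj₂ repeat))) ⟨
    just u             ∎

  forever : anc par (k * d + i) v ≡ just u
  forever = trans (anc-+ par (k * d) (proj₂ (chain (proj₁ repeat)))) (anc-cycle par cycle k)

  k≤k*d : k ≤ k * d
  k≤k*d with d | m<n⇒0<n∸m i<j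
  ... | suc d′ | _ = m≤m*n k (suc d′)

  stops : anc par (k * d + i) v ≡ nothing
  stops = anc-nothing-≤ par (≤-trans k≤k*d (m≤m+n (k * d) i)) eq

isNothing⁺ : ∀ {A : Set} {m : Maybe A} → m ≡ nothing → T (isNothing m)
isNothing⁺ refl = _

isNothing⁻ : ∀ {A : Set} (m : Maybe A) → T (isNothing m) → m ≡ nothing
isNothing⁻ nothing _ = refl

isForest⁺ : ∀ {n} (par : ParentFun n) → Acyclic par → T (isForest par)
isForest⁺ par ac = all⁻ _ (tabulate⁺ (isNothing⁺ ∘ ac))

isForest⁻ : ∀ {n} (par : ParentFun n) → T (isForest par) → Acyclic par
isForest⁻ par h v = isNothing⁻ _ (tabulate⁻ (all⁺ _ (allFin _) h) v)

Desc : ∀ {n} → ParentFun n → Fin n → Fin n → Set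
Desc par x v = ∃ λ k → anc par (suc k) x ≡ just v

isJust-eq⁺ : ∀ {n} {m : Maybe (Fin n)} {v} → m ≡ just v → T (isJust-eq m v)
isJust-eq⁺ {v = v} refl = ≡⇒≡ᵇ (toℕ v) (toℕ v) refl

isJust-eq⁻ : ∀ {n} (m : Maybe (Fin n)) {v} → T (isJust-eq m v) → m ≡ just v
isJust-eq⁻ (just u) {v} h = cong just (toℕ-injective (≡ᵇ⇒≡ (toℕ u) (toℕ v) h))

isDesc⁻ : ∀ {n} (par : ParentFun n) x v → T (isDesc par x v) → Desc par x v
isDesc⁻ {n} par x v h with satisfied (any⁻ _ (upTo n) h)
... | k , hk = k , isJust-eq⁻ _ hk

-- The Boolean test tries only chains of at most `n` steps. Acyclicity rules out longer ones, so it
-- misses nothing.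
isDesc⁺ : ∀ {n} (par : ParentFun n) → Acyclic par → ∀ x v → Desc par x v → T (isDesc par x v)
isDesc⁺ {n} par ac x v (k , eq) with n ≤? k
... | yes n≤k = contradiction
        (trans (sym eq) (anc-nothing-≤ par (m≤n⇒m≤1+n n≤k) (ac x))) λ ()
... | no  n≰k = any⁺ _ (lose (∈-upTo⁺ (≰⇒> n≰k)) (isJust-eq⁺ eq))

-- The root of a vertex

RootOf : ∀ {n} → ParentFun n → Fin n → Fin n → Set
RootOf par v w = (∃ λ k → anc par k v ≡ just w) × lookup par w ≡ nothing

root-exists : ∀ {n} (par : ParentFun n) k {v} → anc par k v ≡ nothing → ∃ (RootOf par v)
root-exists par (suc k) {v} eq with anc par k v in e
... | nothing = root-exists par k e
... | just w  = w , (k , e) , eq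

root-unique-≤ : ∀ {n} (par : ParentFun n) {k k′ v w w′} → k ≤ k′ →
                anc par k v ≡ just w → lookup par w ≡ nothing → anc par k′ v ≡ just w′ → w ≡ w′
root-unique-≤ par {k} {k′} k≤k′ e r e′ with k′ ∸ k | m∸n+n≡m k≤k′
... | zero  | refl = just-injective (trans (sym e) e′)
... | suc d | refl = contradiction (trans (sym e′)
        (anc-nothing-≤ par (s≤s (m≤n+m k d)) (trans (cong (_>>= lookup par) e) r))) λ ()

root-unique : ∀ {n} (par : ParentFun n) {v w w′} → RootOf par v w → RootOf par v w′ → w ≡ w′
root-unique par ((k , e) , r) ((k′ , e′) , r′) with ≤-total k k′
... | inj₁ k≤k′ = root-unique-≤ par k≤k′ e r e′
... | inj₂ k′≤k = sym (root-unique-≤ par k′≤k e′ r′ e)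

root-parent : ∀ {n} (par : ParentFun n) {v u w} → lookup par v ≡ just u →
              RootOf par u w → RootOf par v w
root-parent par e ((k , e′) , r) = (k + 1 , trans (anc-+ par k e) e′) , r

-- Grafting

-- The vertices as the decomposition sees them. Ancestor chains are computed here, where the cases
-- are constructors, and carried to `Fin n` by the injection `emb`.
data Part (a b : ℕ) : Set where
  root : Part a b
  sub  : Fin a → Part a b
  rest : Fin b → Part a b

sub-injective : ∀ {a b x x′} → sub {a} {b} x ≡ sub x′ → x ≡ x′
sub-injective refl = refl

rest-injective : ∀ {a b y y′} → rest {a} {b} y ≡ rest y′ → y ≡ y′
rest-injective refl = refl

inTree : ∀ {a b} → Part a b → Bool
inTree root     = true
inTree (sub _)  = true
inTree (rest _) = false

module _ {a b n} (s : Shuffle (suc a) b n) (r : Fin (suc a)) where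

  emb : Part a b → Fin n
  emb root     = embL s r
  emb (sub x)  = embL s (punchIn r x)
  emb (rest y) = embR s y

  classify : Fin (suc a) → Part a b
  classify x with r ≟ x
  ... | yes _  = root
  ... | no r≢x = sub (punchOut r≢x)

  part : Fin n → Part a b
  part v = [ classify , rest ]′ (locate s v)

  part-emb : ∀ p → part (emb p) ≡ p
  part-emb root rewrite locate-embL s r with r ≟ r
  ... | yes _  = refl
  ... | no r≢r = contradiction refl r≢r
  part-emb (sub x) rewrite locate-embL s (punchIn r x) with r ≟ punchIn r x
  ... | yes eq = contradiction (sym eq) (punchInᵢ≢i r x)
  ... | no  ne = cong sub (trans (punchOut-cong r refl) (punchOut-punchIn r))
  part-emb (rest y) rewrite locate-embR s y = refl

  emb-injective : ∀ {p q} → emb p ≡ emb q → p ≡ q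
  emb-injective {p} {q} eq = trans (sym (part-emb p)) (trans (cong part eq) (part-emb q))

  data Located : Fin n → Set where
    at : ∀ p → Located (emb p)

  located : ∀ v → Located v
  located v with side s v
  ... | inR y = at (rest y)
  ... | inL x with r ≟ x
  ...   | yes refl = at root
  ...   | no r≢x   = subst (Located ∘ embL s) (punchIn-punchOut r≢x) (at (sub (punchOut r≢x)))

  onLeft-emb : ∀ p → onLeft s (emb p) ≡ inTree p
  onLeft-emb root     = onLeft-embL s r
  onLeft-emb (sub x)  = onLeft-embL s (punchIn r x)
  onLeft-emb (rest y) = onLeft-embR s y

  count-emb : (f : Fin n → Bool) →
    count f ≡ ind (f (emb root)) + count (f ∘ emb ∘ sub) + count (f ∘ emb ∘ rest)
  count-emb f = trans (count-shuffle s f)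
    (cong (_+ count (f ∘ embR s)) (count-punchIn r (f ∘ embL s)))

  module _ (P : ParentFun a) (Q : ParentFun b) where

    -- The roots of `P` become children of the new root; `Q` is left as it is.
    step : Part a b → Maybe (Part a b)
    step root     = nothing
    step (sub x)  = just (maybe′ sub root (lookup P x))
    step (rest y) = Maybe.map rest (lookup Q y)

    graft : ParentFun n
    graft = tabulate (Maybe.map emb ∘ step ∘ part)

    lookup-graft : ∀ p → lookup graft (emb p) ≡ Maybe.map emb (step p)
    lookup-graft p = trans (lookup∘tabulate _ (emb p)) (cong (Maybe.map emb ∘ step) (part-emb p))

    steps : ℕ → Part a b → Maybe (Part a b)
    steps zero    p = just p
    steps (suc k) p = steps k p >>= step

    anc-graft : ∀ k p → anc graft k (emb p) ≡ Maybe.map emb (steps k p)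
    anc-graft zero    p = refl
    anc-graft (suc k) p rewrite anc-graft k p with steps k p
    ... | nothing = refl
    ... | just q  = lookup-graft q

    steps-root : ∀ k → steps (suc k) root ≡ nothing
    steps-root zero    = refl
    steps-root (suc k) rewrite steps-root k = refl

    steps-rest : ∀ k y → steps k (rest y) ≡ Maybe.map rest (anc Q k y)
    steps-rest zero    y = refl
    steps-rest (suc k) y rewrite steps-rest k y with anc Q k y
    ... | nothing = refl
    ... | just _  = refl

    steps-sub-just : ∀ k {x x′} → anc P k x ≡ just x′ → steps k (sub x) ≡ just (sub x′)
    steps-sub-just zero    refl = refl
    steps-sub-just (suc k) {x} eq with anc P k x in e
    ... | just u rewrite steps-sub-just k e | eq = refl

    -- A chain that leaves `P` enters the new root and stops one step later. Hence it never returns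
    -- to `sub` and never visits `rest`, which `steps-sub⁻` and `steps-sub-rest` draw from this
    -- alternative.
    steps-sub-nothing : ∀ k {x} → anc P k x ≡ nothing →
                        steps k (sub x) ≡ just root ⊎ steps k (sub x) ≡ nothing
    steps-sub-nothing (suc k) {x} eq with anc P k x in e
    ... | just u rewrite steps-sub-just k e | eq = inj₁ refl
    ... | nothing with steps-sub-nothing k e
    ...   | inj₁ e′ rewrite e′ = inj₂ refl
    ...   | inj₂ e′ rewrite e′ = inj₂ refl

    steps-sub-root : ∀ k {x} → anc P k x ≡ nothing → ∃ λ j → steps (suc j) (sub x) ≡ just root
    steps-sub-root (suc k) {x} eq with anc P k x in e
    ... | just u  = k , trans (cong (_>>= step) (steps-sub-just k e))
                          (cong (just ∘ maybe′ sub root) eq)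
    ... | nothing = steps-sub-root k e

    steps-sub⁻ : ∀ k {x x′} → steps k (sub x) ≡ just (sub x′) → anc P k x ≡ just x′
    steps-sub⁻ k {x} eq with anc P k x in e
    ... | just u  = cong just (sub-injective (just-injective (trans (sym (steps-sub-just k e)) eq)))
    ... | nothing with steps-sub-nothing k e
    ...   | inj₁ e′ with () ← trans (sym e′) eq
    ...   | inj₂ e′ with () ← trans (sym e′) eq

    steps-sub-rest : ∀ k {x y} → steps k (sub x) ≢ just (rest y)
    steps-sub-rest k {x} eq with anc P k x in e
    ... | just u with () ← trans (sym (steps-sub-just k e)) eq
    ... | nothing with steps-sub-nothing k e
    ...   | inj₁ e′ with () ← trans (sym e′) eq
    ...   | inj₂ e′ with () ← trans (sym e′) eq

    steps-rest⁻ : ∀ k {y q} → steps k (rest y) ≡ just q → ∃ λ y′ → q ≡ rest y′ × anc Q k y ≡ just y′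
    steps-rest⁻ k {y} eq with anc Q k y | steps-rest k y
    ... | just y′ | e = y′ , just-injective (trans (sym eq) e) , refl
    ... | nothing | e with () ← trans (sym e) eq

    -- Each part has its own bound: one step for the root, `a` steps plus one through the root for a
    -- vertex of `P`, `b` steps for a vertex of `Q`.
    graft-acyclic : Acyclic P → Acyclic Q → Acyclic graft
    graft-acyclic acP acQ v with located v
    ... | at root     = anc-bound graft 1 (anc-graft 1 root)
    ... | at (sub x)  = anc-bound graft (suc a) (trans (anc-graft (suc a) (sub x)) (cong (Maybe.map emb) gone))
      where
      gone : steps (suc a) (sub x) ≡ nothing
      gone with steps-sub-nothing a (acP x)
      ... | inj₁ e rewrite e = refl
      ... | inj₂ e rewrite e = refl
    ... | at (rest y) = anc-bound graft b (trans (anc-graft b (rest y)) (cong (Maybe.map emb)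
            (trans (steps-rest b y) (cong (Maybe.map rest) (acQ y)))))

    anc-graft⁻ : ∀ k p {q} → anc graft k (emb p) ≡ just (emb q) → steps k p ≡ just q
    anc-graft⁻ k p eq = map-injective emb-injective (trans (sym (anc-graft k p)) eq)

    -- A chain of `P` that survived `n` steps would survive in the graft; `anc-bound` then turns the
    -- bound `n` into the size of `P`.
    acyclic-sub : Acyclic graft → Acyclic P
    acyclic-sub ac x = anc-bound P n stops
      where
      stops : anc P n x ≡ nothing
      stops with anc P n x in e
      ... | nothing = refl
      ... | just _  with () ← trans (sym (ac (emb (sub x))))
                     (trans (anc-graft n (sub x)) (cong (Maybe.map emb) (steps-sub-just n e)))

    acyclic-rest : Acyclic graft → Acyclic Q
    acyclic-rest ac y = anc-bound Q n
      (map-injective rest-injective (trans (sym (steps-rest n y))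
        (map-injective emb-injective (trans (sym (anc-graft n (rest y))) (ac (emb (rest y)))))))

    module _ (acP : Acyclic P) (acQ : Acyclic Q) where

      private ac = graft-acyclic acP acQ

      desc-graft : ∀ {p q} k → steps (suc k) p ≡ just q → T (isDesc graft (emb p) (emb q))
      desc-graft {p} {q} k eq = isDesc⁺ graft ac (emb p) (emb q)
        (k , trans (anc-graft (suc k) p) (cong (Maybe.map emb) eq))

      desc-graft⁻ : ∀ p q → T (isDesc graft (emb p) (emb q)) → ∃ λ k → steps (suc k) p ≡ just q
      desc-graft⁻ p q h with isDesc⁻ graft (emb p) (emb q) h
      ... | k , eq = k , anc-graft⁻ (suc k) p eq

      desc-root : ∀ q → isDesc graft (emb root) (emb q) ≡ false
      desc-root q = T-ext no-desc λ ()
        where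
        no-desc : T (isDesc graft (emb root) (emb q)) → T false
        no-desc h with desc-graft⁻ root q h
        ... | k , eq with () ← trans (sym (steps-root k)) eq

      desc-sub-root : ∀ x → isDesc graft (emb (sub x)) (emb root) ≡ true
      desc-sub-root x = T-ext _ λ _ →
        let j , eq = steps-sub-root a (acP x) in desc-graft {sub x} {root} j eq

      desc-sub-sub : ∀ x x′ → isDesc graft (emb (sub x)) (emb (sub x′)) ≡ isDesc P x x′
      desc-sub-sub x x′ = T-ext
        (λ h → let k , eq = desc-graft⁻ (sub x) (sub x′) h in
               isDesc⁺ P acP x x′ (k , steps-sub⁻ (suc k) eq))
        (λ h → let k , eq = isDesc⁻ P x x′ h in
               desc-graft {sub x} {sub x′} k (steps-sub-just (suc k) eq))

      desc-sub-rest : ∀ x y → isDesc graft (emb (sub x)) (emb (rest y)) ≡ false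
      desc-sub-rest x y = T-ext
        (λ h → let k , eq = desc-graft⁻ (sub x) (rest y) h in ⊥-elim (steps-sub-rest (suc k) eq)) λ ()

      desc-rest-tree : ∀ y q → T (inTree q) → isDesc graft (emb (rest y)) (emb q) ≡ false
      desc-rest-tree y q q∈ = T-ext no-desc λ ()
        where
        no-desc : T (isDesc graft (emb (rest y)) (emb q)) → T false
        no-desc h with desc-graft⁻ (rest y) q h
        ... | k , eq with steps-rest⁻ (suc k) eq
        ...   | _ , refl , _ = q∈

      desc-rest-rest : ∀ y y′ → isDesc graft (emb (rest y)) (emb (rest y′)) ≡ isDesc Q y y′
      desc-rest-rest y y′ = T-ext forth back
        where
        forth : T (isDesc graft (emb (rest y)) (emb (rest y′))) → T (isDesc Q y y′)
        forth h with desc-graft⁻ (rest y) (rest y′) h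
        ... | k , eq with steps-rest⁻ (suc k) eq
        ...   | _ , refl , e = isDesc⁺ Q acQ y y′ (k , e)
        back : T (isDesc Q y y′) → T (isDesc graft (emb (rest y)) (emb (rest y′)))
        back h with isDesc⁻ Q y y′ h
        ... | k , eq = desc-graft {rest y} {rest y′} k
                (trans (steps-rest (suc k) y) (cong (Maybe.map rest) eq))

-- Statistics of grafted forests

invOf : ∀ {n} → ParentFun n → Fin n → ℕ
invOf par v = count (λ x → finLt x v ∧ isDesc par x v)

leadOf : ∀ {n} → ℕ → ParentFun n → ℕ
leadOf i par = count (λ v → invOf par v ≡ᵇ i)

treeOf : ∀ {n} → ParentFun n → ℕ
treeOf par = count (λ v → isNothing (lookup par v))

∧-false : ∀ {p q} → q ≡ false → p ∧ q ≡ false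
∧-false {p} refl = ∧-zeroʳ p

module _ {a b n} (s : Shuffle (suc a) b n) (r : Fin (suc a)) (P : ParentFun a) (Q : ParentFun b) where

  private
    e = emb s r
    G = graft s r P Q

  -- With its converse `root-tree⁻` this describes the tree by the parent function alone, which is
  -- why the shuffle can be recovered from the graft.
  root-tree : Acyclic P → ∀ p → T (inTree p) → RootOf G (e p) (e root)
  root-tree acP p t = reach p t , lookup-graft s r P Q root
    where
    reach : ∀ p → T (inTree p) → ∃ λ k → anc G k (e p) ≡ just (e root)
    reach root    _ = 0 , refl
    reach (sub x) _ = let j , eq = steps-sub-root s r P Q a (acP x) in
      suc j , trans (anc-graft s r P Q (suc j) (sub x)) (cong (Maybe.map e) eq)

  root-tree⁻ : ∀ p → RootOf G (e p) (e root) → T (inTree p)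
  root-tree⁻ root     _ = _
  root-tree⁻ (sub x)  _ = _
  root-tree⁻ (rest y) ((k , eq) , _) with steps-rest⁻ s r P Q k (anc-graft⁻ s r P Q k (rest y) {root} eq)
  ... | _ , () , _

  -- The roots of `P` have acquired a parent and no longer count; the new root and the roots of `Q`
  -- remain.
  treeOf-graft : treeOf G ≡ suc (treeOf Q)
  treeOf-graft = begin
    treeOf G
      ≡⟨ count-emb s r isRoot ⟩
    ind (isRoot (e root)) + count (isRoot ∘ e ∘ sub) + count (isRoot ∘ e ∘ rest)
      ≡⟨ cong₂ _+_ (cong₂ _+_ (cong ind (at-part root)) (count-false (at-part ∘ sub)))
           (count-cong λ y → trans (at-part (rest y)) (map-rest (lookup Q y))) ⟩
    suc (treeOf Q) ∎
    where
    isRoot : Fin n → Bool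
    isRoot v = isNothing (lookup G v)
    at-part : ∀ p → isRoot (e p) ≡ isNothing (Maybe.map e (step s r P Q p))
    at-part p = cong isNothing (lookup-graft s r P Q p)
    map-rest : ∀ m → isNothing (Maybe.map e (Maybe.map rest m)) ≡ isNothing m
    map-rest nothing  = refl
    map-rest (just _) = refl

  module _ (acP : Acyclic P) (acQ : Acyclic Q) where

    private
      below : Fin n → Fin n → Bool
      below v x = finLt x v ∧ isDesc G x v

    -- The descendants of the root are exactly the vertices that come from `P`. Since `embL` and
    -- `punchIn` are increasing, those with a smaller label are as many as the rank says.
    invOf-root : invOf G (e root) ≡ toℕ r
    invOf-root = begin
      count (below v)
        ≡⟨ count-emb s r (below v) ⟩
      ind (below v v) + count (below v ∘ e ∘ sub) + count (below v ∘ e ∘ rest)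
        ≡⟨ cong₂ _+_ (cong₂ _+_
             (cong ind (∧-false {finLt v v} (desc-root s r P Q acP acQ root)))
             (count-cong λ x → trans
               (cong₂ _∧_ (finLt-embL s (punchIn r x) r) (desc-sub-root s r P Q acP acQ x))
               (∧-identityʳ _)))
             (count-false λ y → ∧-false {finLt (e (rest y)) v} (desc-rest-tree s r P Q acP acQ y root _)) ⟩
      count (λ x → finLt (punchIn r x) r) + 0
        ≡⟨ +-identityʳ _ ⟩
      count (λ x → finLt (punchIn r x) r)
        ≡⟨ count-below-punchIn r ⟩
      toℕ r ∎
      where v = e root

    -- The new root descends from no vertex, so its label, however small, adds no inversion
    -- elsewhere.
    invOf-sub : ∀ x → invOf G (e (sub x)) ≡ invOf P x
    invOf-sub x = begin
      count (below v)
        ≡⟨ count-emb s r (below v) ⟩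
      ind (below v (e root)) + count (below v ∘ e ∘ sub) + count (below v ∘ e ∘ rest)
        ≡⟨ cong₂ _+_ (cong₂ _+_
             (cong ind (∧-false {finLt (e root) v} (desc-root s r P Q acP acQ (sub x))))
             (count-cong λ x′ → cong₂ _∧_
               (trans (finLt-embL s (punchIn r x′) (punchIn r x)) (finLt-punchIn r x′ x))
               (desc-sub-sub s r P Q acP acQ x′ x)))
             (count-false λ y → ∧-false {finLt (e (rest y)) v} (desc-rest-tree s r P Q acP acQ y (sub x) _)) ⟩
      invOf P x + 0
        ≡⟨ +-identityʳ _ ⟩
      invOf P x ∎
      where v = e (sub x)

    invOf-rest : ∀ y → invOf G (e (rest y)) ≡ invOf Q y
    invOf-rest y = begin
      count (below v)
        ≡⟨ count-emb s r (below v) ⟩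
      ind (below v (e root)) + count (below v ∘ e ∘ sub) + count (below v ∘ e ∘ rest)
        ≡⟨ cong₂ _+_ (cong₂ _+_
             (cong ind (∧-false {finLt (e root) v} (desc-root s r P Q acP acQ (rest y))))
             (count-false λ x → ∧-false {finLt (e (sub x)) v} (desc-sub-rest s r P Q acP acQ x y)))
             (count-cong λ y′ → cong₂ _∧_ (finLt-embR s y′ y) (desc-rest-rest s r P Q acP acQ y′ y)) ⟩
      invOf Q y ∎
      where v = e (rest y)

    leadOf-graft : ∀ i → leadOf i G ≡ ind (toℕ r ≡ᵇ i) + leadOf i P + leadOf i Q
    leadOf-graft i = begin
      leadOf i G
        ≡⟨ count-emb s r f ⟩
      ind (f (e root)) + count (f ∘ e ∘ sub) + count (f ∘ e ∘ rest)
        ≡⟨ cong₂ _+_ (cong₂ _+_ (cong (λ j → ind (j ≡ᵇ i)) invOf-root)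
             (count-cong (cong (_≡ᵇ i) ∘ invOf-sub))) (count-cong (cong (_≡ᵇ i) ∘ invOf-rest)) ⟩
      ind (toℕ r ≡ᵇ i) + leadOf i P + leadOf i Q ∎
      where
      f : Fin n → Bool
      f v = invOf G v ≡ᵇ i

-- Codes as forests

-- The common value of `lead i` and `lucky i`, as `spine` is that of `tree` and `critic`: each node
-- stands for one root with its inversions, or for one last car with its jump.
level : ∀ {n} → ℕ → Code n → ℕ
level i leaf           = 0
level i (node s r c d) = ind (toℕ r ≡ᵇ i) + level i c + level i d

spine : ∀ {n} → Code n → ℕ
spine leaf           = 0
spine (node s r c d) = suc (spine d)

-- The shuffle of a node omits vertex 0; `left s` puts that vertex into the tree whose root is
-- removed.
parents : ∀ {n} → Code n → ParentFun n
parents leaf           = []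
parents (node s r c d) = graft (left s) r (parents c) (parents d)

parents-acyclic : ∀ {n} (c : Code n) → Acyclic (parents c)
parents-acyclic leaf           ()
parents-acyclic (node s r c d) =
  graft-acyclic (left s) r (parents c) (parents d) (parents-acyclic c) (parents-acyclic d)

forest : ∀ {n} → Code n → Forest n
forest c = parents c , isForest⁺ (parents c) (parents-acyclic c)

lead-forest : ∀ {n} i (c : Code n) → lead i (forest c) ≡ level i c
lead-forest i leaf           = refl
lead-forest i (node s r c d) = trans
  (leadOf-graft (left s) r (parents c) (parents d) (parents-acyclic c) (parents-acyclic d) i)
  (cong₂ _+_ (cong (ind (toℕ r ≡ᵇ i) +_) (lead-forest i c)) (lead-forest i d))

tree-forest : ∀ {n} (c : Code n) → tree (forest c) ≡ spine c
tree-forest leaf           = refl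
tree-forest (node s r c d) =
  trans (treeOf-graft (left s) r (parents c) (parents d)) (cong suc (tree-forest d))

-- Uniqueness of the decomposition of a forest

vec-ext : ∀ {A : Set} {n} {xs ys : Vec A n} → (∀ i → lookup xs i ≡ lookup ys i) → xs ≡ ys
vec-ext {xs = xs} {ys} eq =
  trans (sym (tabulate∘lookup xs)) (trans (tabulate-cong eq) (tabulate∘lookup ys))

maybe-sub-injective : ∀ {a b} {m m′ : Maybe (Fin a)} →
                      maybe′ {B = Part a b} sub root m ≡ maybe′ sub root m′ → m ≡ m′
maybe-sub-injective {m = nothing} {nothing} _  = refl
maybe-sub-injective {m = just _}  {just _}  eq = cong just (sub-injective eq)

module _ {a b n} (s : Shuffle (suc a) b n) (r : Fin (suc a)) {P P′ : ParentFun a} {Q Q′ : ParentFun b}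
  (eq : graft s r P Q ≡ graft s r P′ Q′) where

  step-eq : ∀ p → step s r P Q p ≡ step s r P′ Q′ p
  step-eq p = map-injective (emb-injective s r) (begin
    Maybe.map (emb s r) (step s r P Q p)    ≡⟨ lookup-graft s r P Q p ⟨
    lookup (graft s r P Q) (emb s r p)      ≡⟨ cong (λ par → lookup par (emb s r p)) eq ⟩
    lookup (graft s r P′ Q′) (emb s r p)    ≡⟨ lookup-graft s r P′ Q′ p ⟩
    Maybe.map (emb s r) (step s r P′ Q′ p)  ∎)

  graft-injectiveˡ : P ≡ P′
  graft-injectiveˡ = vec-ext λ x → maybe-sub-injective (just-injective (step-eq (sub x)))

  graft-injectiveʳ : Q ≡ Q′
  graft-injectiveʳ = vec-ext λ y → map-injective rest-injective (step-eq (rest y))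

-- At rank zero vertex 0 is itself the root; at any other rank it is the first of the remaining tree
-- vertices, `sub zero`.
root-zero : ∀ {a b n} (s : Shuffle a b n) r (P : ParentFun a) (Q : ParentFun b) → Acyclic P →
            RootOf (graft (left s) r P Q) zero (embL (left s) r)
root-zero s zero    P Q acP = root-tree (left s) zero P Q acP root _
root-zero {suc a} s (suc r) P Q acP = root-tree (left s) (suc r) P Q acP (sub zero) _

module _ {a b a′ b′ n} (s : Shuffle a b n) (s′ : Shuffle a′ b′ n)
  {r : Fin (suc a)} {r′ : Fin (suc a′)} {P : ParentFun a} {P′ : ParentFun a′}
  {Q : ParentFun b} {Q′ : ParentFun b′}
  (acP : Acyclic P) (acP′ : Acyclic P′)
  (eq : graft (left s) r P Q ≡ graft (left s′) r′ P′ Q′) where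

  roots-agree : embL (left s) r ≡ embL (left s′) r′
  roots-agree = root-unique _ (root-zero s r P Q acP)
    (subst (λ par → RootOf par zero (embL (left s′) r′)) (sym eq) (root-zero s′ r′ P′ Q′ acP′))

  -- Lying on the left means having the same root as vertex 0, a property of the common parent
  -- function. One inclusion suffices, as the two decompositions can be exchanged.
  onLeft-mono : ∀ v → T (onLeft (left s) v) → T (onLeft (left s′) v)
  onLeft-mono v h with located (left s) r v
  ... | at p = go (located (left s′) r′ (emb (left s) r p)) rooted′
    where
    rooted : RootOf (graft (left s) r P Q) (emb (left s) r p) (embL (left s) r)
    rooted = root-tree (left s) r P Q acP p (subst T (onLeft-emb (left s) r p) h)
    rooted′ : RootOf (graft (left s′) r′ P′ Q′) (emb (left s) r p) (embL (left s′) r′)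
    rooted′ = subst₂ (λ par w → RootOf par (emb (left s) r p) w) eq roots-agree rooted
    -- The vertex is generalised to `u` so that the view for the second decomposition can be
    -- matched; `emb (left s) r p` is not a variable.
    go : ∀ {u} → Located (left s′) r′ u → RootOf (graft (left s′) r′ P′ Q′) u (embL (left s′) r′) →
         T (onLeft (left s′) u)
    go (at q) h = subst T (sym (onLeft-emb (left s′) r′ q)) (root-tree⁻ (left s′) r′ P′ Q′ q h)

parents-injective : ∀ {n} (c c′ : Code n) → parents c ≡ parents c′ → c ≡ c′
parents-injective leaf leaf _ = refl
parents-injective (node s r c d) (node s′ r′ c′ d′) eq
  with onLeft-injective s s′ (λ i → T-ext
         (onLeft-mono s s′ (parents-acyclic c) (parents-acyclic c′) eq (suc i))
         (onLeft-mono s′ s (parents-acyclic c′) (parents-acyclic c) (sym eq) (suc i)))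
... | refl with embL-injective (left s) (roots-agree s s (parents-acyclic c) (parents-acyclic c′) eq)
...   | refl = cong₂ (node s r)
        (parents-injective c c′ (graft-injectiveˡ (left s) r eq))
        (parents-injective d d′ (graft-injectiveʳ (left s) r eq))

Σ-T-≡ : ∀ {A : Set} {f : A → Bool} {x y : Σ A (T ∘ f)} → proj₁ x ≡ proj₁ y → x ≡ y
Σ-T-≡ {x = x , p} {.x , q} refl = cong (x ,_) (T-irrelevant p q)

forest-injective : ∀ {n} {c c′ : Code n} → forest c ≡ forest c′ → c ≡ c′
forest-injective {c = c} {c′} eq = parents-injective c c′ (cong proj₁ eq)

-- Existence of the decomposition of a forest

module _ {a b n} (s : Shuffle (suc a) b n) (r : Fin (suc a)) (par : ParentFun n) (ac : Acyclic par)
  (tree⁺ : ∀ p → T (inTree p) → RootOf par (emb s r p) (emb s r root))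
  (tree⁻ : ∀ p → RootOf par (emb s r p) (emb s r root) → T (inTree p)) where

  private e = emb s r

  -- A vertex and its parent have the same root, and the hypotheses describe the tree by its root.
  tree-closed : ∀ p {q} → lookup par (e p) ≡ just (e q) → T (inTree p) → T (inTree q)
  tree-closed p {q} eq t with root-exists par n (ac (e q))
  ... | w , q⇝w with root-unique par (root-parent par eq q⇝w) (tree⁺ p t)
  ...   | refl = tree⁻ q q⇝w

  -- A parentless tree vertex would be its own root and so equal to the chosen one. The value
  -- `nothing` records that the parent is the removed root, making the vertex a root of `P`.
  parent-sub : ∀ x → ∃ λ m → lookup par (e (sub x)) ≡ just (e (maybe′ sub root m))
  parent-sub x with lookup par (e (sub x)) in eq
  ... | nothing with () ← emb-injective s r {sub x} {root}
                            (root-unique par ((0 , refl) , eq) (tree⁺ (sub x) _))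
  ... | just u with located s r u
  ...   | at root     = nothing , refl
  ...   | at (sub x′) = just x′ , refl
  ...   | at (rest y) = ⊥-elim (tree-closed (sub x) {rest y} eq _)

  -- A parent inside the tree would pull the vertex into the tree.
  parent-rest : ∀ y → ∃ λ m → lookup par (e (rest y)) ≡ Maybe.map (e ∘ rest) m
  parent-rest y with lookup par (e (rest y)) in eq
  ... | nothing = nothing , refl
  ... | just u with located s r u
  ...   | at root      = ⊥-elim (tree⁻ (rest y) (root-parent par eq (tree⁺ root _)))
  ...   | at (sub x)   = ⊥-elim (tree⁻ (rest y) (root-parent par eq (tree⁺ (sub x) _)))
  ...   | at (rest y′) = just y′ , refl

  ungraft : Σ (ParentFun a) λ P → Σ (ParentFun b) λ Q → graft s r P Q ≡ par
  ungraft = P , Q , vec-ext agree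
    where
    P = tabulate (proj₁ ∘ parent-sub)
    Q = tabulate (proj₁ ∘ parent-rest)
    step-agree : ∀ p → Maybe.map e (step s r P Q p) ≡ lookup par (e p)
    step-agree root     = sym (proj₂ (tree⁺ root _))
    step-agree (sub x)  = trans
      (cong (just ∘ e ∘ maybe′ sub root) (lookup∘tabulate (proj₁ ∘ parent-sub) x))
      (sym (proj₂ (parent-sub x)))
    step-agree (rest y) = trans
      (cong (Maybe.map e ∘ Maybe.map rest) (lookup∘tabulate (proj₁ ∘ parent-rest) y))
      (trans (sym (map-∘ (proj₁ (parent-rest y)))) (sym (proj₂ (parent-rest y))))
    agree : ∀ v → lookup (graft s r P Q) v ≡ lookup par v
    agree v with located s r v
    ... | at p = trans (lookup-graft s r P Q p) (step-agree p)

onLeft⇒embL : ∀ {a b n} (s : Shuffle a b n) v → T (onLeft s v) → ∃ λ x → v ≡ embL s x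
onLeft⇒embL s v h with side s v
... | inL x = x , refl
... | inR y = ⊥-elim (subst T (onLeft-embR s y) h)

Decomposition : ∀ {n} → ParentFun (suc n) → Set
Decomposition {n} par =
  Σ ℕ λ a → Σ ℕ λ b → Σ (Shuffle a b n) λ s → Σ (Fin (suc a)) λ r →
  Σ (ParentFun a) λ P → Σ (ParentFun b) λ Q → graft (left s) r P Q ≡ par

module _ {n} (par : ParentFun (suc n)) (ac : Acyclic par)
  (rootOf : Fin (suc n) → Fin (suc n)) (rootOf-spec : ∀ v → RootOf par v (rootOf v)) where

  module _ {a b} (s : Shuffle a b n)
    (onLeft-root : ∀ v → onLeft (left s) v ≡ does (rootOf v ≟ rootOf zero)) where

    onLeft⁺ : ∀ v → RootOf par v (rootOf zero) → T (onLeft (left s) v)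
    onLeft⁺ v v⇝ρ = subst T (sym (trans (onLeft-root v)
      (dec-true (rootOf v ≟ rootOf zero) (root-unique par (rootOf-spec v) v⇝ρ)))) _

    onLeft⁻ : ∀ v → T (onLeft (left s) v) → RootOf par v (rootOf zero)
    onLeft⁻ v h with rootOf v ≟ rootOf zero | onLeft-root v
    ... | yes eq | _ = subst (RootOf par v) eq (rootOf-spec v)
    ... | no  _  | e = ⊥-elim (subst T e h)

    decompose-shuffle : ∀ r → rootOf zero ≡ embL (left s) r → Decomposition par
    decompose-shuffle r eq = a , b , s , r , ungraft (left s) r par ac
      (λ p h → subst (RootOf par _) eq (onLeft⁻ _ (subst T (sym (onLeft-emb (left s) r p)) h)))
      (λ p h → subst T (onLeft-emb (left s) r p) (onLeft⁺ _ (subst (RootOf par _) (sym eq) h)))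

    decompose-left : Decomposition par
    decompose-left =
      let r , eq = onLeft⇒embL (left s) (rootOf zero)
                     (onLeft⁺ (rootOf zero) ((0 , refl) , proj₂ (rootOf-spec zero)))
      in decompose-shuffle r eq

  -- The left side collects the vertices whose root is that of vertex 0. That root is its own root,
  -- hence lies there too, and its position is the rank.
  decompose : Decomposition par
  decompose with shuffleOf (λ v → does (rootOf (suc v) ≟ rootOf zero))
  ... | _ , _ , s , h = decompose-left s λ
    { zero    → sym (dec-true (rootOf zero ≟ rootOf zero) refl)
    ; (suc v) → h v }

shuffle-<ˡ : ∀ {a b n} → Shuffle a b n → a < suc n
shuffle-<ˡ {a} {b} s = s≤s (subst (a ≤_) (shuffle-size s) (m≤m+n a b))

shuffle-<ʳ : ∀ {a b n} → Shuffle a b n → b < suc n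
shuffle-<ʳ {a} {b} s = s≤s (subst (b ≤_) (shuffle-size s) (m≤n+m b a))

parents-surjective : ∀ {n} → Acc _<_ n → (par : ParentFun n) → Acyclic par → ∃ λ c → parents c ≡ par
parents-surjective {zero}  _        []  _ = leaf , refl
parents-surjective {suc n} (acc wf) par ac = rebuild
  (decompose par ac (λ v → proj₁ (root-exists par (suc n) (ac v)))
                    (λ v → proj₂ (root-exists par (suc n) (ac v)))) ac
  where
  -- With `par` generalised, the equation of the decomposition matches `refl`, and acyclicity of
  -- `par` becomes acyclicity of the graft.
  rebuild : ∀ {par} → Decomposition par → Acyclic par → ∃ λ c → parents c ≡ par
  rebuild (a , b , s , r , P , Q , refl) ac =
    let c , c≡ = parents-surjective (wf (shuffle-<ˡ s)) P (acyclic-sub (left s) r P Q ac)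
        d , d≡ = parents-surjective (wf (shuffle-<ʳ s)) Q (acyclic-rest (left s) r P Q ac)
    in node s r c d , cong₂ (graft (left s) r) c≡ d≡

forest-surjective : ∀ {n} (F : Forest n) → ∃ λ c → forest c ≡ F
forest-surjective {n} (par , h) with parents-surjective (<-wellFounded n) par (isForest⁻ par h)
... | c , eq = c , Σ-T-≡ eq

-- The parking process, for an arbitrary set of occupied spaces

Occupied : Set₁
Occupied = ℕ → Set

_∪｛_｝ : Occupied → ℕ → Occupied
(O ∪｛ q ｝) x = x ≡ q ⊎ O x

record FirstFree (O : Occupied) (p q : ℕ) : Set where
  constructor firstFree
  field
    p≤q   : p ≤ q
    taken : ∀ x → p ≤ x → x < q → O x
    free  : ¬ O q

-- As a relation that sees the occupied spaces only as a set, the process can be cut at a space. By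
-- `park-unique` it is deterministic, so exhibiting places proves what `spaces` computes.
Park : Occupied → ∀ {n} → Vec ℕ n → Vec ℕ n → Set
Park O []       []       = ⊤
Park O (p ∷ ps) (q ∷ qs) = FirstFree O p q × Park (O ∪｛ q ｝) ps qs

∅ : Occupied
∅ _ = ⊥

_≐_ : Occupied → Occupied → Set
O ≐ O′ = ∀ x → (O x → O′ x) × (O′ x → O x)

firstFree-resp : ∀ {O O′ p q} → O ≐ O′ → FirstFree O p q → FirstFree O′ p q
firstFree-resp eq (firstFree p≤q taken free) = firstFree p≤q
  (λ x p≤x x<q → proj₁ (eq x) (taken x p≤x x<q)) (free ∘ proj₂ (eq _))

firstFree-unique : ∀ {O p q q′} → FirstFree O p q → FirstFree O p q′ → q ≡ q′
firstFree-unique {q = q} {q′} (firstFree p≤q t f) (firstFree p≤q′ t′ f′) with <-cmp q q′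
... | tri< q<q′ _ _ = ⊥-elim (f (t′ q p≤q q<q′))
... | tri≈ _ eq _   = eq
... | tri> _ _ q>q′ = ⊥-elim (f′ (t q′ p≤q′ q>q′))

park-unique : ∀ {n O} (ps : Vec ℕ n) {qs qs′} → Park O ps qs → Park O ps qs′ → qs ≡ qs′
park-unique []       {[]}     {[]}      _       _         = refl
park-unique (p ∷ ps) {q ∷ qs} {q′ ∷ qs′} (f , h) (f′ , h′) with firstFree-unique f f′
... | refl = cong (q ∷_) (park-unique ps h h′)

memb⁺ : ∀ {x xs} → x ∈ xs → T (memb x xs)
memb⁺ {x} x∈xs = any⁺ _ (Any.map (≡⇒≡ᵇ x _) x∈xs)

memb⁻ : ∀ x xs → T (memb x xs) → x ∈ xs
memb⁻ x xs h = Any.map (≡ᵇ⇒≡ x _) (any⁻ _ xs h)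

-- Each occupied space that findFree passes lowers this count, which therefore bounds the fuel needed.
above : ℕ → List ℕ → ℕ
above p List.[]       = 0
above p (x List.∷ xs) = ind (p ≤ᵇ x) + above p xs

above≤length : ∀ p xs → above p xs ≤ List.length xs
above≤length p List.[]       = z≤n
above≤length p (x List.∷ xs) with p ≤ᵇ x
... | true  = s≤s (above≤length p xs)
... | false = m≤n⇒m≤1+n (above≤length p xs)

ind-≤ᵇ-suc : ∀ p x → ind (suc p ≤ᵇ x) ≤ ind (p ≤ᵇ x)
ind-≤ᵇ-suc p x with suc p ≤ᵇ x in eq
... | false = z≤n
... | true  = ≤-reflexive (cong ind (sym (Equivalence.to T-≡
                (≤⇒≤ᵇ (<⇒≤ (≤ᵇ⇒≤ (suc p) x (Equivalence.from T-≡ eq)))))))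

above-suc-≤ : ∀ p xs → above (suc p) xs ≤ above p xs
above-suc-≤ p List.[]       = z≤n
above-suc-≤ p (x List.∷ xs) = +-mono-≤ (ind-≤ᵇ-suc p x) (above-suc-≤ p xs)

above-suc-< : ∀ {p xs} → p ∈ xs → above (suc p) xs < above p xs
above-suc-< {p} {x List.∷ xs} (there p∈xs) =
  +-mono-≤-< (ind-≤ᵇ-suc p x) (above-suc-< p∈xs)
above-suc-< {p} {x List.∷ xs} (here refl)
  rewrite Equivalence.to T-≡ (≤⇒≤ᵇ (≤-refl {p})) with p <ᵇ p in eq
... | false = s≤s (above-suc-≤ p xs)
... | true  = ⊥-elim (<-irrefl refl (<ᵇ⇒< p p (Equivalence.from T-≡ eq)))

findFree-first : ∀ fuel xs p → above p xs < fuel → FirstFree (_∈ xs) p (findFree fuel xs p)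
findFree-first (suc fuel) xs p (s≤s bound) with memb p xs in eq
... | false = firstFree ≤-refl (λ x p≤x x<p → ⊥-elim (<⇒≱ x<p p≤x))
                (λ p∈xs → subst T eq (memb⁺ p∈xs))
... | true  = extend (findFree-first fuel xs (suc p) (<-≤-trans (above-suc-< p∈xs) bound))
  where
  p∈xs = memb⁻ p xs (Equivalence.from T-≡ eq)
  extend : ∀ {q} → FirstFree (_∈ xs) (suc p) q → FirstFree (_∈ xs) p q
  extend (firstFree p<q taken free) = firstFree (<⇒≤ p<q) taken′ free
    where
    taken′ : ∀ x → p ≤ x → x < _ → x ∈ xs
    taken′ x p≤x x<q with m≤n⇒m<n∨m≡n p≤x
    ... | inj₁ p<x  = taken x p<x x<q
    ... | inj₂ refl = p∈xs

∈-∷-≐ : ∀ {O xs} q → (_∈ xs) ≐ O → (_∈ (q List.∷ xs)) ≐ (O ∪｛ q ｝)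
∈-∷-≐ q eq x = (λ { (here e) → inj₁ e ; (there h) → inj₂ (proj₁ (eq x) h) }) ,
               (λ { (inj₁ e) → here e ; (inj₂ h) → there (proj₂ (eq x) h) })

park-parkFrom : ∀ {n O} xs → (_∈ xs) ≐ O → (ps : Vec ℕ n) → Park O ps (parkFrom xs ps)
park-parkFrom xs eq []       = _
park-parkFrom xs eq (p ∷ ps) =
  firstFree-resp eq (findFree-first _ xs p (s≤s (above≤length p xs))) ,
  park-parkFrom (_ List.∷ xs) (∈-∷-≐ _ eq) ps

park-spaces : ∀ {n} (ps : Vec ℕ n) → Park ∅ ps (spaces ps)
park-spaces = park-parkFrom List.[] λ x → (λ ()) , λ ()

park-≤ : ∀ {n O} (ps : Vec ℕ n) {qs} → Park O ps qs → ∀ i → lookup ps i ≤ lookup qs i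
park-≤ (p ∷ ps) {q ∷ qs} (f , h) zero    = FirstFree.p≤q f
park-≤ (p ∷ ps) {q ∷ qs} (f , h) (suc i) = park-≤ ps h i

park-fresh : ∀ {n O} (ps : Vec ℕ n) {qs} → Park O ps qs → ∀ i → ¬ O (lookup qs i)
park-fresh (p ∷ ps) {q ∷ qs} (f , h) zero    = FirstFree.free f
park-fresh (p ∷ ps) {q ∷ qs} (f , h) (suc i) = park-fresh ps h i ∘ inj₂

park-distinct : ∀ {n O} (ps : Vec ℕ n) {qs} → Park O ps qs →
                ∀ {i j} → lookup qs i ≡ lookup qs j → i ≡ j
park-distinct (p ∷ ps) {q ∷ qs} (f , h) {zero}  {zero}  eq = refl
park-distinct (p ∷ ps) {q ∷ qs} (f , h) {zero}  {suc j} eq = ⊥-elim (park-fresh ps h j (inj₁ (sym eq)))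
park-distinct (p ∷ ps) {q ∷ qs} (f , h) {suc i} {zero}  eq = ⊥-elim (park-fresh ps h i (inj₁ eq))
park-distinct (p ∷ ps) {q ∷ qs} (f , h) {suc i} {suc j} eq = cong suc (park-distinct ps h eq)

-- The places are distinct and lie between 1 and `m`; lowered by 1 they inject into `Fin m`.
park-size : ∀ {n m O} (ps : Vec ℕ n) {qs} → Park O ps qs → (∀ i → 1 ≤ lookup ps i) →
            (∀ i → lookup qs i ≤ m) → n ≤ m
park-size {n} {m} ps {qs} h pos bnd =
  injective⇒≤ {f = λ i → fromℕ< (in-range i)} λ {i} {j} eq →
    park-distinct ps h (∸-cancelʳ-≡ (pos′ i) (pos′ j) (fromℕ<-injective _ _ (in-range i) (in-range j) eq))
  where
  pos′ : ∀ i → 1 ≤ lookup qs i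
  pos′ i = ≤-trans (pos i) (park-≤ ps h i)
  in-range : ∀ i → lookup qs i ∸ 1 < m
  in-range i with lookup qs i | pos′ i | bnd i
  ... | suc q | _ | q<m = q<m

_∪_ : ∀ {n} → Occupied → Vec ℕ n → Occupied
(O ∪ qs) x = (∃ λ i → lookup qs i ≡ x) ⊎ O x

∪-∷ : ∀ {n O} q (qs : Vec ℕ n) → (O ∪ (q ∷ qs)) ≐ ((O ∪｛ q ｝) ∪ qs)
∪-∷ q qs x =
  (λ { (inj₁ (zero , e)) → inj₂ (inj₁ (sym e)) ; (inj₁ (suc i , e)) → inj₁ (i , e) ; (inj₂ o) → inj₂ (inj₂ o) }) ,
  (λ { (inj₁ (i , e)) → inj₁ (suc i , e) ; (inj₂ (inj₁ e)) → inj₁ (zero , sym e) ; (inj₂ (inj₂ o)) → inj₂ o })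

≐-sym : ∀ {O O′} → O ≐ O′ → O′ ≐ O
≐-sym eq x = proj₂ (eq x) , proj₁ (eq x)

-- `Park` recurses on the first car while codes split off the last, which meets the places of all
-- others as occupied.
park-∷ʳ⁺ : ∀ {n O p q} (ps : Vec ℕ n) {qs} → Park O ps qs → FirstFree (O ∪ qs) p q →
           Park O (ps ∷ʳ p) (qs ∷ʳ q)
park-∷ʳ⁺ []       {[]}     _       f = firstFree-resp (λ x → (λ { (inj₂ o) → o ; (inj₁ (() , _)) }) , inj₂) f , _
park-∷ʳ⁺ (_ ∷ ps) {q ∷ qs} (g , h) f = g , park-∷ʳ⁺ ps h (firstFree-resp (∪-∷ q qs) f)

park-∷ʳ⁻ : ∀ {n O p q} (ps qs : Vec ℕ n) → Park O (ps ∷ʳ p) (qs ∷ʳ q) →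
           Park O ps qs × FirstFree (O ∪ qs) p q
park-∷ʳ⁻ []       []       (f , _) = _ , firstFree-resp (λ x → inj₂ , (λ { (inj₂ o) → o ; (inj₁ (() , _)) })) f
park-∷ʳ⁻ (_ ∷ ps) (q ∷ qs) (g , h) =
  let h′ , f = park-∷ʳ⁻ ps qs h in (g , h′) , firstFree-resp (≐-sym (∪-∷ q qs)) f

-- Parking below and above a space that stays empty

join : ∀ {a b n} → ℕ → Shuffle a b n → Vec ℕ a → Vec ℕ b → Vec ℕ n
join k []        []       []       = []
join k (left s)  (x ∷ xs) ys       = x ∷ join k s xs ys
join k (right s) xs       (y ∷ ys) = (k + y) ∷ join k s xs ys

lookup-joinˡ : ∀ {a b n} k (s : Shuffle a b n) xs ys x → lookup (join k s xs ys) (embL s x) ≡ lookup xs x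
lookup-joinˡ k (left s)  (_ ∷ _) ys      zero    = refl
lookup-joinˡ k (left s)  (_ ∷ xs) ys     (suc x) = lookup-joinˡ k s xs ys x
lookup-joinˡ k (right s) xs      (_ ∷ ys) x      = lookup-joinˡ k s xs ys x

lookup-joinʳ : ∀ {a b n} k (s : Shuffle a b n) xs ys y → lookup (join k s xs ys) (embR s y) ≡ k + lookup ys y
lookup-joinʳ k (left s)  (_ ∷ xs) ys       y       = lookup-joinʳ k s xs ys y
lookup-joinʳ k (right s) xs       (_ ∷ _)  zero    = refl
lookup-joinʳ k (right s) xs       (_ ∷ ys) (suc y) = lookup-joinʳ k s xs ys y

join-elim : ∀ {a b n} k (s : Shuffle a b n) xs ys (P : ℕ → Set) →
            (∀ x → P (lookup xs x)) → (∀ y → P (k + lookup ys y)) → ∀ i → P (lookup (join k s xs ys) i)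
join-elim k s xs ys P f g i with side s i
... | inL x = subst P (sym (lookup-joinˡ k s xs ys x)) (f x)
... | inR y = subst P (sym (lookup-joinʳ k s xs ys y)) (g y)

-- The street cut at `k`. Space `k` becomes space 0 of the upper street, in front of its first
-- proper space.
record Splits (k : ℕ) (O O₁ O₂ : Occupied) : Set where
  field
    low   : ∀ {x} → x < k → O x → O₁ x
    low⁻  : ∀ {x} → x < k → O₁ x → O x
    high  : ∀ {y} → O (k + y) → O₂ y
    high⁻ : ∀ {y} → O₂ y → O (k + y)
open Splits

splits-∅ : ∀ {k} → Splits k ∅ ∅ ∅
splits-∅ = record { low = λ _ x → x ; low⁻ = λ _ x → x ; high = λ x → x ; high⁻ = λ x → x }

k+y≮k : ∀ {k y} → ¬ (k + y < k)
k+y≮k {k} {y} = ≤⇒≯ (m≤m+n k y)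

splits-low : ∀ {k O O₁ O₂ q} → q < k → Splits k O O₁ O₂ → Splits k (O ∪｛ q ｝) (O₁ ∪｛ q ｝) O₂
splits-low q<k S = record
  { low   = λ x<k → Sum.map₂ (low S x<k)
  ; low⁻  = λ x<k → Sum.map₂ (low⁻ S x<k)
  ; high  = λ { (inj₁ refl) → ⊥-elim (k+y≮k q<k) ; (inj₂ o) → high S o }
  ; high⁻ = inj₂ ∘ high⁻ S
  }

splits-high : ∀ {k O O₁ O₂ q} → Splits k O O₁ O₂ → Splits k (O ∪｛ k + q ｝) O₁ (O₂ ∪｛ q ｝)
splits-high {k} S = record
  { low   = λ { x<k (inj₁ refl) → ⊥-elim (k+y≮k x<k) ; x<k (inj₂ o) → low S x<k o }
  ; low⁻  = λ x<k → inj₂ ∘ low⁻ S x<k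
  ; high  = Sum.map (+-cancelˡ-≡ k _ _) (high S)
  ; high⁻ = Sum.map (cong (k +_)) (high⁻ S)
  }

module _ {k O O₁ O₂} (S : Splits k O O₁ O₂) where

  -- A search that ends below `k` inspects no space from `k` on.
  firstFree-low⁺ : ∀ {p q} → q < k → FirstFree O₁ p q → FirstFree O p q
  firstFree-low⁺ q<k (firstFree p≤q taken free) = firstFree p≤q
    (λ x p≤x x<q → low⁻ S (<-trans x<q q<k) (taken x p≤x x<q)) (free ∘ low S q<k)

  firstFree-low⁻ : ∀ {p q} → q < k → FirstFree O p q → FirstFree O₁ p q
  firstFree-low⁻ q<k (firstFree p≤q taken free) = firstFree p≤q
    (λ x p≤x x<q → low S (<-trans x<q q<k) (taken x p≤x x<q)) (free ∘ low⁻ S q<k)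

  firstFree-high⁺ : ∀ {p q} → FirstFree O₂ p q → FirstFree O (k + p) (k + q)
  firstFree-high⁺ {p} {q} (firstFree p≤q taken free) = firstFree (+-monoʳ-≤ k p≤q) taken′ (free ∘ high S)
    where
    taken′ : ∀ x → k + p ≤ x → x < k + q → O x
    taken′ x k+p≤x x<k+q with m≤n⇒∃[o]m+o≡n (m+n≤o⇒m≤o k k+p≤x)
    ... | y , refl = high⁻ S (taken y (+-cancelˡ-≤ k _ _ k+p≤x) (+-cancelˡ-< k _ _ x<k+q))

  firstFree-high⁻ : ∀ {p q} → FirstFree O (k + p) (k + q) → FirstFree O₂ p q
  firstFree-high⁻ (firstFree p≤q taken free) = firstFree (+-cancelˡ-≤ k _ _ p≤q)
    (λ y p≤y y<q → high S (taken (k + y) (+-monoʳ-≤ k p≤y) (+-monoʳ-< k y<q))) (free ∘ high⁻ S)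

-- Left cars stop below `k` and right cars start no earlier than `k`, so neither group inspects a
-- space of the other.
park-join : ∀ {a b n k O O₁ O₂} (s : Shuffle a b n) {xs us ys vs} → Splits k O O₁ O₂ →
            Park O₁ xs us → Park O₂ ys vs → (∀ i → lookup us i < k) →
            Park O (join k s xs ys) (join k s us vs)
park-join []        {[]}    {[]}    {[]} {[]}       S g h bnd = _
park-join (left s)  {_ ∷ _} {_ ∷ _}                 S (f , g) h bnd =
  firstFree-low⁺ S (bnd zero) f , park-join s (splits-low (bnd zero) S) g h (bnd ∘ suc)
park-join (right s) {ys = _ ∷ _} {_ ∷ _}            S g (f , h) bnd =
  firstFree-high⁺ S f , park-join s (splits-high S) g h bnd

record Unjoined (k : ℕ) (O₁ O₂ : Occupied) {n} (ps qs : Vec ℕ n) : Set where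
  constructor unjoined
  field
    {a b}     : ℕ
    s         : Shuffle a b n
    {xs us}   : Vec ℕ a
    {ys vs}   : Vec ℕ b
    ps≡       : ps ≡ join k s xs ys
    qs≡       : qs ≡ join k s us vs
    park-low  : Park O₁ xs us
    park-high : Park O₂ ys vs
    us<k      : ∀ i → lookup us i < k
    ys>0      : ∀ i → 1 ≤ lookup ys i

∀-∷ : ∀ {n} {P : ℕ → Set} {x} {xs : Vec ℕ n} → P x → (∀ i → P (lookup xs i)) → ∀ i → P (lookup (x ∷ xs) i)
∀-∷ px pxs zero    = px
∀-∷ px pxs (suc i) = pxs i

-- No car parks at `k`, so `k` stays free and no search crosses it: a car parked beyond `k` also
-- prefers a space beyond `k`.
park-unjoin : ∀ {n k O O₁ O₂} (ps qs : Vec ℕ n) → Splits k O O₁ O₂ → ¬ O k → Park O ps qs →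
              (∀ i → lookup qs i ≢ k) → Unjoined k O₁ O₂ ps qs
park-unjoin [] [] S ¬Ok h ne = unjoined [] {[]} {[]} {[]} {[]} refl refl _ _ (λ ()) (λ ())
park-unjoin {k = k} (p ∷ ps) (q ∷ qs) S ¬Ok (f , h) ne with <-cmp q k
... | tri≈ _ q≡k _ = ⊥-elim (ne zero q≡k)
... | tri< q<k _ _
  with park-unjoin ps qs (splits-low q<k S) (λ { (inj₁ e) → ne zero (sym e) ; (inj₂ o) → ¬Ok o }) h (ne ∘ suc)
... | unjoined s refl refl g₁ g₂ us<k ys>0 =
  unjoined (left s) refl refl (firstFree-low⁻ S q<k f , g₁) g₂ (∀-∷ {P = _< k} q<k us<k) ys>0
park-unjoin {k = k} {O} (p ∷ ps) (q ∷ qs) S ¬Ok (f , h) ne | tri> _ _ k<q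
  with m≤n⇒∃[o]m+o≡n (<⇒≤ k<q)
     | m≤n⇒∃[o]m+o≡n {suc k} {p} (≰⇒> λ p≤k → ¬Ok (FirstFree.taken f k p≤k k<q))
... | q′ , refl | p′ , refl
  with park-unjoin ps qs (splits-high S) (λ { (inj₁ e) → ne zero (sym e) ; (inj₂ o) → ¬Ok o }) h (ne ∘ suc)
-- The preference is `suc k + p′`, which in the upper street reads `suc p′` and is therefore
-- positive.
... | unjoined s {xs} {_} {ys} refl refl g₁ g₂ us<k ys>0 =
  unjoined (right s) (cong (_∷ join k s xs ys) (sym (+-suc k p′))) refl g₁
    (firstFree-high⁻ S (subst (λ x → FirstFree O x (k + q′)) (sym (+-suc k p′)) f) , g₂)
    us<k (∀-∷ {P = 1 ≤_} (s≤s z≤n) ys>0)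

lookup-∷ʳ-inject₁ : ∀ {A : Set} {n} (xs : Vec A n) x i → lookup (xs ∷ʳ x) (inject₁ i) ≡ lookup xs i
lookup-∷ʳ-inject₁ (_ ∷ _)  x zero    = refl
lookup-∷ʳ-inject₁ (_ ∷ xs) x (suc i) = lookup-∷ʳ-inject₁ xs x i

lookup-∷ʳ-fromℕ : ∀ {A : Set} {n} (xs : Vec A n) x → lookup (xs ∷ʳ x) (fromℕ n) ≡ x
lookup-∷ʳ-fromℕ []       x = refl
lookup-∷ʳ-fromℕ (_ ∷ xs) x = lookup-∷ʳ-fromℕ xs x

∷ʳ-elim : ∀ {n} (xs : Vec ℕ n) x (P : ℕ → Set) → (∀ i → P (lookup xs i)) → P x → ∀ i → P (lookup (xs ∷ʳ x) i)
∷ʳ-elim xs x P f p i with view i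
... | ‵fromℕ     = subst P (sym (lookup-∷ʳ-fromℕ xs x)) p
... | ‵inject₁ i = subst P (sym (lookup-∷ʳ-inject₁ xs x i)) (f i)

-- Codes as parking functions

prefs : ∀ {n} → Code n → Vec ℕ n
prefs leaf               = []
-- Starting `r` spaces before the free space `suc a` gives jump `r`; as `r` is at most `a`, the
-- preference is positive.
prefs (node {a} s r c d) = join (suc a) s (prefs c) (prefs d) ∷ʳ (suc a ∸ toℕ r)

places : ∀ {n} → Code n → Vec ℕ n
places leaf               = []
places (node {a} s r c d) = join (suc a) s (places c) (places d) ∷ʳ suc a

prefs-positive : ∀ {n} (c : Code n) i → 1 ≤ lookup (prefs c) i
prefs-positive (node {a} s r c d) = ∷ʳ-elim (join (suc a) s (prefs c) (prefs d)) _ (1 ≤_)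
  (join-elim (suc a) s (prefs c) (prefs d) (1 ≤_) (prefs-positive c) (λ _ → s≤s z≤n))
  (m<n⇒0<n∸m (toℕ<n r))

places-≤ : ∀ {n} (c : Code n) i → lookup (places c) i ≤ n
places-≤ (node {a} {b} {n} s r c d) = ∷ʳ-elim (join (suc a) s (places c) (places d)) _ (_≤ suc n)
  (join-elim (suc a) s (places c) (places d) (_≤ suc n)
    (λ x → m≤n⇒m≤1+n (≤-trans (places-≤ c x) (s≤s⁻¹ (shuffle-<ˡ s))))
    (λ y → s≤s (≤-trans (+-monoʳ-≤ a (places-≤ d y)) (≤-reflexive (shuffle-size s)))))
  (shuffle-<ˡ s)

places-positive : ∀ {n} (c : Code n) i → 1 ≤ lookup (places c) i
places-positive (node {a} {b} {n} s r c d) = ∷ʳ-elim (join (suc a) s (places c) (places d)) _ (1 ≤_)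
  (join-elim (suc a) s (places c) (places d) (1 ≤_) (places-positive c) (λ _ → s≤s z≤n))
  (s≤s z≤n)

-- Left cars fill 1 to `a`, the last car takes `suc a`, right cars fill the rest. `park-code` needs
-- this: every space that the last car passes must be full.
places-onto : ∀ {n} (c : Code n) {x} → 1 ≤ x → x ≤ n → ∃ λ i → lookup (places c) i ≡ x
places-onto leaf (s≤s _) ()
places-onto (node {a} {b} {n} s r c d) {x} 1≤x x≤n = locate-place (<-cmp x (suc a))
  where
  qs = join (suc a) s (places c) (places d)
  locate-place : _ → ∃ λ i → lookup (qs ∷ʳ suc a) i ≡ x
  locate-place (tri≈ _ refl _) = fromℕ n , lookup-∷ʳ-fromℕ qs (suc a)
  locate-place (tri< x<k _ _) with places-onto c 1≤x (s≤s⁻¹ x<k)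
  ... | i , refl = inject₁ (embL s i) ,
          trans (lookup-∷ʳ-inject₁ qs (suc a) _) (lookup-joinˡ (suc a) s (places c) (places d) i)
  locate-place (tri> _ _ k<x) with m≤n⇒∃[o]m+o≡n k<x
  ... | y , refl with places-onto d {suc y} (s≤s z≤n)
                        (+-cancelˡ-≤ (suc a) _ _ (≤-trans (≤-reflexive (+-suc (suc a) y))
                          (≤-trans x≤n (≤-reflexive (cong suc (sym (shuffle-size s)))))))
  ...   | i , eq = inject₁ (embR s i) ,
            trans (lookup-∷ʳ-inject₁ qs (suc a) _)
              (trans (lookup-joinʳ (suc a) s (places c) (places d) i)
                (trans (cong (suc a +_) eq) (+-suc (suc a) y)))

park-code : ∀ {n} (c : Code n) → Park ∅ (prefs c) (places c)
park-code leaf = _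
park-code (node {a} s r c d) =
  park-∷ʳ⁺ (join (suc a) s (prefs c) (prefs d))
    (park-join s splits-∅ (park-code c) (park-code d) (s≤s ∘ places-≤ c))
    (firstFree (m∸n≤m (suc a) (toℕ r)) taken free)
  where
  qs = join (suc a) s (places c) (places d)
  taken : ∀ x → suc a ∸ toℕ r ≤ x → x < suc a → (∅ ∪ qs) x
  taken x p≤x x≤a with places-onto c (≤-trans (m<n⇒0<n∸m (toℕ<n r)) p≤x) (s≤s⁻¹ x≤a)
  ... | i , eq = inj₁ (embL s i , trans (lookup-joinˡ (suc a) s (places c) (places d) i) eq)
  free : ¬ (∅ ∪ qs) (suc a)
  free (inj₁ (i , eq)) = join-elim (suc a) s (places c) (places d) (_≢ suc a)
    (λ x → <⇒≢ (s≤s (places-≤ c x)))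
    (λ y → >⇒≢ (m<m+n (suc a) (places-positive d y)))
    i eq

spaces-prefs : ∀ {n} (c : Code n) → spaces (prefs c) ≡ places c
spaces-prefs c = park-unique (prefs c) (park-spaces (prefs c)) (park-code c)

all-toList⁺ : ∀ {n} (f : ℕ → Bool) (xs : Vec ℕ n) → (∀ i → T (f (lookup xs i))) → T (all f (toList xs))
all-toList⁺ f []       h = _
all-toList⁺ f (x ∷ xs) h = Equivalence.from T-∧ (h zero , all-toList⁺ f xs (h ∘ suc))

all-toList⁻ : ∀ {n} (f : ℕ → Bool) (xs : Vec ℕ n) → T (all f (toList xs)) → ∀ i → T (f (lookup xs i))
all-toList⁻ f (x ∷ xs) h zero    = proj₁ (Equivalence.to (T-∧ {f x}) h)
all-toList⁻ f (x ∷ xs) h (suc i) = all-toList⁻ f xs (proj₂ (Equivalence.to (T-∧ {f x}) h)) i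

isParking⁺ : ∀ {n} (ps : Vec ℕ n) → (∀ i → 1 ≤ lookup ps i) →
             (∀ i → lookup (spaces ps) i ≤ n) → T (isParking ps)
isParking⁺ ps pos bnd = Equivalence.from T-∧
  (all-toList⁺ _ ps (≤⇒≤ᵇ ∘ pos) , all-toList⁺ _ (spaces ps) (≤⇒≤ᵇ ∘ bnd))

isParking⁻ : ∀ {n} (ps : Vec ℕ n) → T (isParking ps) →
             (∀ i → 1 ≤ lookup ps i) × (∀ i → lookup (spaces ps) i ≤ n)
isParking⁻ {n} ps h = let pos , bnd = Equivalence.to (T-∧ {all (1 ≤ᵇ_) (toList ps)}) h in
  (λ i → ≤ᵇ⇒≤ 1 _ (all-toList⁻ _ ps pos i)) , (λ i → ≤ᵇ⇒≤ _ n (all-toList⁻ _ (spaces ps) bnd i))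

parking : ∀ {n} → Code n → PF n
parking {n} c = prefs c , isParking⁺ (prefs c) (prefs-positive c)
  (subst (λ qs → ∀ i → lookup qs i ≤ n) (sym (spaces-prefs c)) (places-≤ c))

-- Uniqueness and existence of the code of a parking function

onLeft-join : ∀ {a b n} k (s : Shuffle a b n) xs ys → (∀ x → lookup xs x < k) →
              ∀ i → onLeft s i ≡ (lookup (join k s xs ys) i <ᵇ k)
onLeft-join k s xs ys bnd i with side s i
... | inL x rewrite lookup-joinˡ k s xs ys x =
  trans (onLeft-embL s x) (sym (Equivalence.to T-≡ (<⇒<ᵇ (bnd x))))
... | inR y rewrite lookup-joinʳ k s xs ys y =
  trans (onLeft-embR s y) (T-ext ⊥-elim (λ h → k+y≮k (<ᵇ⇒< (k + lookup ys y) k h)))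

join-injective : ∀ {a b n} k (s : Shuffle a b n) {xs xs′ ys ys′} →
                 join k s xs ys ≡ join k s xs′ ys′ → xs ≡ xs′ × ys ≡ ys′
join-injective k s {xs} {xs′} {ys} {ys′} eq =
  vec-ext (λ x → trans (sym (lookup-joinˡ k s xs ys x))
    (trans (cong (λ v → lookup v (embL s x)) eq) (lookup-joinˡ k s xs′ ys′ x))) ,
  vec-ext (λ y → +-cancelˡ-≡ k _ _ (trans (sym (lookup-joinʳ k s xs ys y))
    (trans (cong (λ v → lookup v (embR s y)) eq) (lookup-joinʳ k s xs′ ys′ y))))

prefs-injective : ∀ {n} (c c′ : Code n) → prefs c ≡ prefs c′ → c ≡ c′
prefs-injective leaf leaf _ = refl
prefs-injective (node {a} s r c d) (node {a′} s′ r′ c′ d′) eq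
  -- Equal preferences have equal places. The last place is `suc a`, so the sizes agree; comparing
  -- the other places with it gives the shuffle.
  with ∷ʳ-injective (join (suc a) s (prefs c) (prefs d)) (join (suc a′) s′ (prefs c′) (prefs d′)) eq
     | ∷ʳ-injective (join (suc a) s (places c) (places d)) (join (suc a′) s′ (places c′) (places d′))
         (trans (sym (spaces-prefs (node s r c d))) (trans (cong spaces eq) (spaces-prefs (node s′ r′ c′ d′))))
... | ps≡ , p≡ | qs≡ , refl
  with onLeft-injective s s′ (λ i →
         trans (onLeft-join (suc a) s (places c) (places d) (s≤s ∘ places-≤ c) i)
           (trans (cong (λ v → lookup v i <ᵇ suc a) qs≡)
             (sym (onLeft-join (suc a) s′ (places c′) (places d′) (s≤s ∘ places-≤ c′) i))))
... | refl
  with join-injective (suc a) s ps≡ | toℕ-injective (∸-cancelˡ-≡ (<⇒≤ (toℕ<n r)) (<⇒≤ (toℕ<n r′)) p≡)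
... | c≡ , d≡ | refl = cong₂ (node s r) (prefs-injective c c′ c≡) (prefs-injective d d′ d≡)

parking-injective : ∀ {n} {c c′ : Code n} → parking c ≡ parking c′ → c ≡ c′
parking-injective {c = c} {c′} eq = prefs-injective c c′ (cong proj₁ eq)

-- Room for `k` cars in front and `n ∸ k` behind is just enough for all `n`, so both bounds are
-- attained.
block-size : ∀ {a b n k} → a + b ≡ n → suc k ≤ suc n → a ≤ k → b ≤ n ∸ k → a ≡ k
block-size {b = b} {k = k} a+b≡n (s≤s k≤n) a≤k b≤n∸k = ≤-antisym a≤k (+-cancelʳ-≤ b k _
  (≤-trans (+-monoʳ-≤ k b≤n∸k) (≤-reflexive (trans (m+[n∸m]≡n k≤n) (sym a+b≡n)))))

-- The place of the last car is free for all others, so `park-unjoin` cuts there; `park-size` bounds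
-- both groups and `block-size` fixes their sizes.
prefs-surjective : ∀ {n} → Acc _<_ n → (ps qs : Vec ℕ n) → Park ∅ ps qs →
  (∀ i → 1 ≤ lookup ps i) → (∀ i → lookup qs i ≤ n) → ∃ λ c → prefs c ≡ ps
prefs-surjective {zero}  _        []  _   _ _   _   = leaf , refl
prefs-surjective {suc n} (acc wf) ps₊ qs₊ h pos bnd with initLast ps₊ | initLast qs₊
... | ps , p , refl | qs , zero , refl = contradiction
  (≤-trans (pos (fromℕ n)) (subst (_ ≤_) (lookup-∷ʳ-fromℕ qs 0) (park-≤ (ps ∷ʳ p) h (fromℕ n)))) λ ()
... | ps , p , refl | qs , suc k , refl = last-car (park-∷ʳ⁻ ps qs h)
  where
  1≤p : 1 ≤ p
  1≤p = subst (1 ≤_) (lookup-∷ʳ-fromℕ ps p) (pos (fromℕ n))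
  pos′ : ∀ i → 1 ≤ lookup ps i
  pos′ i = subst (1 ≤_) (lookup-∷ʳ-inject₁ ps p i) (pos (inject₁ i))
  bnd′ : ∀ i → lookup qs i ≤ suc n
  bnd′ i = subst (_≤ suc n) (lookup-∷ʳ-inject₁ qs (suc k) i) (bnd (inject₁ i))
  k≤ : suc k ≤ suc n
  k≤ = subst (_≤ suc n) (lookup-∷ʳ-fromℕ qs (suc k)) (bnd (fromℕ n))

  assemble : p ≤ suc k → Unjoined (suc k) ∅ ∅ ps qs → ∃ λ c → prefs c ≡ ps ∷ʳ p
  assemble p≤ (unjoined {a} {b} s {xs} {us} {ys} {vs} ps≡ qs≡ g₁ g₂ us<k ys>0)
    = finish (block-size (shuffle-size s) k≤ a≤k b≤n∸k)
    where
    xs>0 : ∀ x → 1 ≤ lookup xs x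
    xs>0 x = subst (1 ≤_) (trans (cong (λ v → lookup v (embL s x)) ps≡) (lookup-joinˡ (suc k) s xs ys x))
                   (pos′ (embL s x))
    vs≤ : ∀ y → lookup vs y ≤ n ∸ k
    vs≤ y = m+n≤o⇒m≤o∸n (lookup vs y) (≤-trans (≤-reflexive (+-comm (lookup vs y) k)) (s≤s⁻¹
      (subst (_≤ suc n) (trans (cong (λ v → lookup v (embR s y)) qs≡) (lookup-joinʳ (suc k) s us vs y))
                   (bnd′ (embR s y)))))
    a≤k : a ≤ k
    a≤k = park-size xs g₁ xs>0 (s≤s⁻¹ ∘ us<k)
    b≤n∸k : b ≤ n ∸ k
    b≤n∸k = park-size ys g₂ ys>0 vs≤
    finish : a ≡ k → ∃ λ c → prefs c ≡ ps ∷ʳ p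
    finish refl =
      let c , c≡ = prefs-surjective (wf (shuffle-<ˡ s)) xs us g₁ xs>0 (s≤s⁻¹ ∘ us<k)
          d , d≡ = prefs-surjective (wf (shuffle-<ʳ s)) ys vs g₂ ys>0
                     (λ y → ≤-trans (vs≤ y) (≤-reflexive (trans (cong (_∸ a) (sym (shuffle-size s))) (m+n∸m≡n a b))))
          -- The rank is forced to be the jump `suc a ∸ p`, which is at most `a` because `p` is
          -- positive.
          r<   = ∸-monoʳ-< 1≤p p≤
      in node s (fromℕ< r<) c d ,
         cong₂ _∷ʳ_ (trans (cong₂ (join (suc a) s) c≡ d≡) (sym ps≡))
                    (trans (cong (suc a ∸_) (toℕ-fromℕ< r<)) (m∸[m∸n]≡n p≤))

  last-car : Park ∅ ps qs × FirstFree (∅ ∪ qs) p (suc k) → ∃ λ c → prefs c ≡ ps ∷ʳ p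
  last-car (g , firstFree p≤ taken free) =
    assemble p≤ (park-unjoin ps qs splits-∅ (λ ()) g λ i eq → free (inj₁ (i , eq)))

parking-surjective : ∀ {n} (P : PF n) → ∃ λ c → parking c ≡ P
parking-surjective {n} (ps , h) =
  let pos , bnd = isParking⁻ ps h
      c , eq    = prefs-surjective (<-wellFounded n) ps (spaces ps) (park-spaces ps) pos bnd
  in c , Σ-T-≡ eq

-- Jumps and critical cars read off the code

luckyOf : ∀ {n} → ℕ → Vec ℕ n → Vec ℕ n → ℕ
luckyOf i qs ps = count (λ c → (lookup qs c ∸ lookup ps c) ≡ᵇ i)

luckyOf-code : ∀ {n} i (c : Code n) → luckyOf i (places c) (prefs c) ≡ level i c
luckyOf-code i leaf = refl
luckyOf-code {suc n} i (node {a} s r c d) = begin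
  count jumps
    ≡⟨ count-snoc jumps ⟩
  ind (jumps (fromℕ n)) + count (jumps ∘ inject₁)
    ≡⟨ cong₂ _+_ (cong (λ j → ind (j ≡ᵇ i)) last-jump) (count-shuffle s (jumps ∘ inject₁)) ⟩
  ind (toℕ r ≡ᵇ i) + (count (jumps ∘ inject₁ ∘ embL s) + count (jumps ∘ inject₁ ∘ embR s))
    ≡⟨ +-assoc (ind (toℕ r ≡ᵇ i)) _ _ ⟨
  ind (toℕ r ≡ᵇ i) + count (jumps ∘ inject₁ ∘ embL s) + count (jumps ∘ inject₁ ∘ embR s)
    ≡⟨ cong₂ (λ x y → ind (toℕ r ≡ᵇ i) + x + y)
         (trans (count-cong (cong (_≡ᵇ i) ∘ low-jump)) (luckyOf-code i c))
         (trans (count-cong (cong (_≡ᵇ i) ∘ high-jump)) (luckyOf-code i d)) ⟩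
  ind (toℕ r ≡ᵇ i) + level i c + level i d ∎
  where
  k = suc a
  qs = join k s (places c) (places d)
  ps = join k s (prefs c) (prefs d)

  jumps : Fin (suc n) → Bool
  jumps v = (lookup (qs ∷ʳ k) v ∸ lookup (ps ∷ʳ (k ∸ toℕ r)) v) ≡ᵇ i

  last-jump : lookup (qs ∷ʳ k) (fromℕ n) ∸ lookup (ps ∷ʳ (k ∸ toℕ r)) (fromℕ n) ≡ toℕ r
  last-jump = trans (cong₂ _∸_ (lookup-∷ʳ-fromℕ qs k) (lookup-∷ʳ-fromℕ ps (k ∸ toℕ r)))
                    (m∸[m∸n]≡n (<⇒≤ (toℕ<n r)))

  low-jump : ∀ x → lookup (qs ∷ʳ k) (inject₁ (embL s x)) ∸ lookup (ps ∷ʳ (k ∸ toℕ r)) (inject₁ (embL s x))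
                   ≡ lookup (places c) x ∸ lookup (prefs c) x
  low-jump x = cong₂ _∸_
    (trans (lookup-∷ʳ-inject₁ qs k _) (lookup-joinˡ k s (places c) (places d) x))
    (trans (lookup-∷ʳ-inject₁ ps _ _) (lookup-joinˡ k s (prefs c) (prefs d) x))

  -- The shift by `k` occurs in both place and preference and cancels.
  high-jump : ∀ y → lookup (qs ∷ʳ k) (inject₁ (embR s y)) ∸ lookup (ps ∷ʳ (k ∸ toℕ r)) (inject₁ (embR s y))
                    ≡ lookup (places d) y ∸ lookup (prefs d) y
  high-jump y = trans (cong₂ _∸_
    (trans (lookup-∷ʳ-inject₁ qs k _) (lookup-joinʳ k s (places c) (places d) y))
    (trans (lookup-∷ʳ-inject₁ ps _ _) (lookup-joinʳ k s (prefs c) (prefs d) y)))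
    ([m+n]∸[m+o]≡n∸o k _ _)

lucky-parking : ∀ {n} i (c : Code n) → lucky i (parking c) ≡ level i c
lucky-parking i c = trans (cong (λ qs → luckyOf i qs (prefs c)) (spaces-prefs c)) (luckyOf-code i c)

criticalAt : ∀ {n} → Vec ℕ n → Fin n → Bool
criticalAt {n} qs c = all (λ d → not (lookup qs c <ᵇ lookup qs d) ∨ finLt d c) (allFin n)

Critical : ∀ {n} → Vec ℕ n → Fin n → Set
Critical qs c = ∀ d → lookup qs c < lookup qs d → T (finLt d c)

criticalAt⁺ : ∀ {n} (qs : Vec ℕ n) c → Critical qs c → T (criticalAt qs c)
criticalAt⁺ qs c h = all⁻ _ (tabulate⁺ implies)
  where
  implies : ∀ d → T (not (lookup qs c <ᵇ lookup qs d) ∨ finLt d c)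
  implies d with lookup qs c <ᵇ lookup qs d in eq
  ... | false = _
  ... | true  = h d (<ᵇ⇒< _ _ (Equivalence.from T-≡ eq))

criticalAt⁻ : ∀ {n} (qs : Vec ℕ n) c → T (criticalAt qs c) → Critical qs c
criticalAt⁻ {n} qs c h d c<d =
  subst (λ p → T (not p ∨ finLt d c)) (Equivalence.to T-≡ (<⇒<ᵇ c<d)) (tabulate⁻ (all⁺ _ (allFin n) h) d)

finLt-inject₁ : ∀ {n} (c d : Fin n) → finLt (inject₁ c) (inject₁ d) ≡ finLt c d
finLt-inject₁ c d = cong₂ _<ᵇ_ (toℕ-inject₁ c) (toℕ-inject₁ d)

finLt-fromℕ : ∀ {n} (c : Fin n) → ¬ T (finLt (fromℕ n) (inject₁ c))
finLt-fromℕ {n} c h =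
  <-asym (subst₂ _<_ (toℕ-fromℕ n) (toℕ-inject₁ c) (<ᵇ⇒< _ _ h)) (toℕ<n c)

inject₁-finLt-fromℕ : ∀ {n} (c : Fin n) → T (finLt (inject₁ c) (fromℕ n))
inject₁-finLt-fromℕ {n} c = <⇒<ᵇ (subst₂ _<_ (sym (toℕ-inject₁ c)) (sym (toℕ-fromℕ n)) (toℕ<n c))

module _ {a b n} (k : ℕ) (s : Shuffle a b n) (us : Vec ℕ a) (vs : Vec ℕ b) (us<k : ∀ x → lookup us x < k)
  (vs>0 : ∀ y → 1 ≤ lookup vs y) where

  private
    qs : Vec ℕ (suc n)
    qs = join k s us vs ∷ʳ k

  at-low : ∀ x → lookup qs (inject₁ (embL s x)) ≡ lookup us x
  at-low x = trans (lookup-∷ʳ-inject₁ (join k s us vs) k (embL s x)) (lookup-joinˡ k s us vs x)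

  at-high : ∀ y → lookup qs (inject₁ (embR s y)) ≡ k + lookup vs y
  at-high y = trans (lookup-∷ʳ-inject₁ (join k s us vs) k (embR s y)) (lookup-joinʳ k s us vs y)

  at-last : lookup qs (fromℕ n) ≡ k
  at-last = lookup-∷ʳ-fromℕ (join k s us vs) k

  critical-last : criticalAt qs (fromℕ n) ≡ true
  critical-last = Equivalence.to T-≡ (criticalAt⁺ qs (fromℕ n) earlier)
    where
    earlier : Critical qs (fromℕ n)
    earlier d c<d with view d
    ... | ‵fromℕ     = ⊥-elim (<-irrefl refl c<d)
    ... | ‵inject₁ d = inject₁-finLt-fromℕ d

  -- The last car arrives later and parks further on.
  critical-low : ∀ x → criticalAt qs (inject₁ (embL s x)) ≡ false
  critical-low x = T-ext (λ h → finLt-fromℕ (embL s x)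
    (criticalAt⁻ qs _ h (fromℕ n) (subst₂ _<_ (sym (at-low x)) (sym at-last) (us<k x)))) λ ()

  -- Only right cars park beyond a right car, and their order of arrival is preserved by `embR`.
  critical-high : ∀ y → criticalAt qs (inject₁ (embR s y)) ≡ criticalAt vs y
  critical-high y = T-ext
    (λ h → criticalAt⁺ vs y λ y′ y<y′ →
      subst T (trans (finLt-inject₁ (embR s y′) (embR s y)) (finLt-embR s y′ y))
        (criticalAt⁻ qs _ h (inject₁ (embR s y′))
          (subst₂ _<_ (sym (at-high y)) (sym (at-high y′)) (+-monoʳ-< k y<y′))))
    (λ h → criticalAt⁺ qs _ (later h))
    where
    later : T (criticalAt vs y) → Critical qs (inject₁ (embR s y))
    later h d c<d with view d
    ... | ‵fromℕ = ⊥-elim (k+y≮k (subst₂ _<_ (at-high y) at-last c<d))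
    ... | ‵inject₁ d with side s d
    ...   | inL x  = ⊥-elim (k+y≮k (<-trans (subst₂ _<_ (at-high y) (at-low x) c<d) (us<k x)))
    ...   | inR y′ = subst T (sym (trans (finLt-inject₁ (embR s y′) (embR s y)) (finLt-embR s y′ y)))
              (criticalAt⁻ vs y h y′ (+-cancelˡ-< k _ _ (subst₂ _<_ (at-high y) (at-high y′) c<d)))

  count-critical : count (criticalAt qs) ≡ suc (count (criticalAt vs))
  count-critical = trans (count-snoc (criticalAt qs)) (cong₂ _+_ (cong ind critical-last)
    (trans (count-shuffle s (criticalAt qs ∘ inject₁))
      (cong₂ _+_ (count-false critical-low) (count-cong critical-high))))

count-critical-code : ∀ {n} (c : Code n) → count (criticalAt (places c)) ≡ spine c
count-critical-code leaf = refl
count-critical-code (node {a} s r c d) = trans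
  (count-critical (suc a) s (places c) (places d) (s≤s ∘ places-≤ c) (places-positive d))
  (cong suc (count-critical-code d))

critic-parking : ∀ {n} (c : Code n) → critic (parking c) ≡ spine c
critic-parking c = trans (cong (λ qs → count (criticalAt qs)) (spaces-prefs c)) (count-critical-code c)

-- The bijection through codes

forest-bijection : ∀ n → Code n ⤖ Forest n
forest-bijection n = mk⤖ (forest-injective , strictlySurjective⇒surjective forest-surjective)

parking-bijection : ∀ n → Code n ⤖ PF n
parking-bijection n = mk⤖ (parking-injective , strictlySurjective⇒surjective parking-surjective)

statistics : ∀ {n} (c : Code n) {F} → forest c ≡ F →
             (tinv F ≡ tjump (parking c)) × (tree F ≡ critic (parking c))
statistics c refl =
  tabulate-cong (λ i → trans (lead-forest (toℕ i) c) (sym (lucky-parking (toℕ i) c))) ,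
  trans (tree-forest c) (sym (critic-parking c))

mainTheorem1 : (n : ℕ) → 1 ≤ n →
    Σ (Forest n ⤖ PF n) (λ φ → (F : Forest n) →
    (tinv F ≡ tjump (Bijection.to φ F)) × (tree F ≡ critic (Bijection.to φ F)))
mainTheorem1 n _ = parking-bijection n ⤖-∘ ⤖-sym (forest-bijection n) , λ F →
  -- The inverse bijection sends `F` to this very witness of surjectivity, so the image of `F`
  -- computes to `parking c`.
  let c , eq = forest-surjective F in statistics c eq
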